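{- For every $n\ge1$, $$\sum_{\sigma\in\mathfrak S_n}\mathbf{\Psi}^\sigma=\sum_{I,J\,\vDash\, n}c_{IJ}(q)\,R_I^{(J)},$$ where the sum is over all pairs of compositions of $n$ and $$c_{IJ}(q)=\begin{cases}0&\text{if }\mathrm{Des}(I)\setminus\mathrm{Des}(I)^-\not\subset\mathrm{Des}(J),\\ (-q)^{|\mathrm{Des}(I)\setminus\mathrm{Des}(J)|}\,(1-q)^{|\mathrm{Des}(I)\cap\mathrm{Des}(J)|}&\text{otherwise.}\end{cases}$$
   Context: Scalars: $q$ is an indeterminate (scalar parameter). Biwords. For $n\ge 0$, a permutation $\tau\in\mathfrak S_n$ (written as a word) and a word $u=u_1\cdots u_n$ of positive integers (a color word), let $\binom{u}{\tau}$ denote a formal basis element (this is $\mathbf G_{\tau,u}$ in the algebra of colored free quasi-symmetric functions; top row = colors, bottom row = permutation). Product: $\binom{u}{\alpha}\binom{v}{\beta}=\sum_{\gamma\in\alpha*\beta}\binom{uv}{\gamma}$, where, for $\alpha\in\mathfrak S_a$, $\beta\in\mathfrak S_b$, $\alpha*\beta$ is the set (formal sum) of all $\gamma\in\mathfrak S_{a+b}$ which, written $\gamma=xy$ with $|x|=a$, $|y|=b$, satisfy $\mathrm{std}(x)=\alpha$, $\mathrm{std}(y)=\beta$; $\mathrm{std}$ denotes standardization (the permutation with the same relative order of letters). The elements $\Psi^u$. For a color word $u=u_1\cdots u_p$, regard $(u_i,i)$ as biletters, set $B_1=(u_1,1)$ and $B_i=[B_{i-1},(u_i,i)]_q$ for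 $i\ge2$, where $[x,y]_q=xy-q\,yx$ and products of biletters are concatenation of words in biletters. Interpreting each resulting word in biletters as a biword (colors on top, numbers below), put $\Psi^u:=B_p$. E.g. $\Psi^{312}=\binom{312}{123}-q\binom{132}{213}-q\binom{231}{312}+q^2\binom{213}{321}$. A word $u=u_1\cdots u_p$ is initially dominated if $u_1>u_i$ for all $i>1$. Each word has a unique factorization $u=u^{(1)}u^{(2)}\cdots u^{(p)}$ into initially dominated words whose first letters satisfy $u^{(1)}_1\le u^{(2)}_1\le\cdots\le u^{(p)}_1$. For $\sigma\in\mathfrak S_n$ with this factorization, $\mathbf\Psi^\sigma:=\Psi^{u^{(1)}}\Psi^{u^{(2)}}\cdots\Psi^{u^{(p)}}$ (product of biwords above), and the saillance composition of $\sigma$ is $S(\sigma):=(|u^{(1)}|,\dots,|u^{(p)}|)$. Compositions. $I\vDash n$ means $I$ is a composition of $n$. For $I=(i_1,\dots,i_s)\vDash n$, $\mathrm{Des}(I)=\{i_1,i_1+i_2,\dots,i_1+\cdots+i_{s-1}\}$ and $\mathrm{Des}(I)^-=\{d-1: d\in\mathrm{Des}(I)\}$. The descent composition $D(\tau)$ of $\tau\in\mathfrak S_n$ is the composition whose parts are the lengths of the maximal increasing factors of $\tau$. For $I,J\vDash n$ let $R_I^{(J)}:=\sum_{\tau,\sigma\in\mathfrak S_n:\ D(\tau)=I,\ S(\sigma)=J}\binom{\sigma}{\tau}$. -}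

module Defs where

open import Algebra.Bundles using (CommutativeRing)
open import Data.Bool.Base using (if_then_else_)
open import Data.List.Base using (List; []; _∷_; _++_; [_]; map; concatMap; foldr; foldl; filter; length; zip; take; drop; takeWhile; dropWhile; upTo; cartesianProductWith)
open import Data.List.NonEmpty.Base as List⁺ using (List⁺; _∷_; toList; head)
open import Data.List.Membership.DecPropositional using () renaming (_∈?_ to member?)
open import Data.List.Properties using (≡-dec; concatMap-++; takeWhile++dropWhile)
import Data.List.Relation.Binary.Subset.DecPropositional as Subset
open import Data.List.Relation.Unary.All as All using (All; []; _∷_)
import Data.List.Relation.Unary.All.Properties as All
import Data.List.Relation.Unary.AllPairs as AllPairs
open import Data.List.Relation.Unary.Linked using (Linked; []; [-]; _∷_)
import Data.List.Relation.Unary.Linked.Properties as Linked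
import Data.List.Relation.Unary.Unique.DecPropositional as Unique
open import Data.Nat.Base as ℕ using (ℕ; zero; suc; _≤_; _<_)
open import Data.Nat.ListAction using (sum)
open import Data.Nat.Properties using (_≟_; _<?_; _≤?_; ≤-trans; <-trans; ≤⇒≯; ≮⇒≥; <⇒≤)
open import Data.Product.Base using (_×_; _,_; proj₁; proj₂)
open import Data.Product.Properties using () renaming (≡-dec to ×-≡-dec)
open import Relation.Binary.Definitions using (DecidableEquality)
open import Relation.Binary.PropositionalEquality.Core using (_≡_; refl; sym; trans; cong; cong₂; subst)
open import Relation.Nullary.Decidable.Core using (yes; no; does; _×-dec_; ¬?)
open import Relation.Nullary.Negation.Core using (¬_; contradiction)
open import Relation.Unary using (Decidable)

Word : Set
Word = List ℕ

_≟ʷ_ : DecidableEquality Word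
_≟ʷ_ = ≡-dec _≟_

[1⋯_] : ℕ → List ℕ
[1⋯ n ] = map suc (upTo n)

words : ℕ → List ℕ → List Word
words zero    A = [ [] ]
words (suc k) A = cartesianProductWith _∷_ A (words k A)

-- Permutations are written as words: 𝔖 n lists the words of length n over
-- {1, …, n} without repeated letter.
𝔖 : ℕ → List Word
𝔖 n = filter (Unique.unique? _≟_) (words n [1⋯ n ])

-- A composition of n is a list of positive integers with sum n; such a list
-- has at most n parts, each at most n.
compositions : ℕ → List (List ℕ)
compositions n =
  filter (λ I → sum I ≟ n) (concatMap (λ k → words k [1⋯ n ]) (upTo (suc n)))

-- Standardization, for words without repeated letters: each letter is
-- replaced by its rank.
std : Word → Word
std w = map (λ x → length (filter (_≤? x) w)) w

-- The γ ∈ 𝔖 (a + b) occurring in α * β, for α ∈ 𝔖 a and β ∈ 𝔖 b.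
_∗_ : Word → Word → List Word
α ∗ β =
  filter (λ γ → (std (take a γ) ≟ʷ α) ×-dec (std (drop a γ) ≟ʷ β))
         (𝔖 (a ℕ.+ length β))
  where a = length α

------------------------------------------------------------------------
-- Descents

prepend : ℕ → List (List⁺ ℕ) → List (List⁺ ℕ)
prepend x []             = (x ∷ []) ∷ []
prepend x ((y ∷ w) ∷ fs) =
  if does (x <? y) then (x ∷ y ∷ w) ∷ fs else (x ∷ []) ∷ (y ∷ w) ∷ fs

-- The maximal increasing factors, from left to right.
increasingFactors : Word → List (List⁺ ℕ)
increasingFactors = foldr prepend []

descentComposition : Word → List ℕ
descentComposition τ = map List⁺.length (increasingFactors τ)

-- Finite sets of natural numbers are given by duplicate-free lists.
Des : List ℕ → List ℕ
Des []          = []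
Des (i ∷ [])    = []
Des (i ∷ j ∷ I) = i ∷ map (i ℕ.+_) (Des (j ∷ I))

Des⁻ : List ℕ → List ℕ
Des⁻ I = map ℕ.pred (Des I)

_∖_ _∩_ : List ℕ → List ℕ → List ℕ
A ∖ B = filter (λ x → ¬? (member? _≟_ x B)) A
A ∩ B = filter (λ x → member? _≟_ x B) A

------------------------------------------------------------------------
-- Factorization into initially dominated words

InitiallyDominated : List⁺ ℕ → Set
InitiallyDominated (x ∷ w) = All (_< x) w

record IsDominatedFactorization (u : Word) (fs : List (List⁺ ℕ)) : Set where
  field
    product   : concatMap toList fs ≡ u
    dominated : All InitiallyDominated fs
    monotone  : Linked (λ f g → head f ≤ head g) fs

-- Scanning from the right, a new letter x absorbs the initial factors whose
-- first letter is smaller than x. The lemmas isDominatedFactorization and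
-- dominatedFactorization-unique show that the result is the unique
-- factorization satisfying IsDominatedFactorization.
absorb : ℕ → List (List⁺ ℕ) → List (List⁺ ℕ)
absorb x fs =
  (x ∷ concatMap toList (takeWhile (λ f → head f <? x) fs))
  ∷ dropWhile (λ f → head f <? x) fs

dominatedFactorization : Word → List (List⁺ ℕ)
dominatedFactorization = foldr absorb []

saillanceComposition : Word → List ℕ
saillanceComposition σ = map List⁺.length (dominatedFactorization σ)

private
  product-absorb : ∀ x fs →
    concatMap toList (absorb x fs) ≡ x ∷ concatMap toList fs
  product-absorb x fs = cong (x ∷_)
    (trans (sym (concatMap-++ toList (takeWhile (λ f → head f <? x) fs) _))
           (cong (concatMap toList)
                 (takeWhile++dropWhile (λ f → head f <? x) fs)))

  dominated-concat : ∀ {x} fs → All InitiallyDominated fs →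
    All (λ f → head f < x) fs → All (_< x) (concatMap toList fs)
  dominated-concat [] [] [] = []
  dominated-concat ((y ∷ w) ∷ fs) (d ∷ ds) (y<x ∷ hs) =
    All.++⁺ (y<x ∷ All.map (λ z<y → <-trans z<y y<x) d)
            (dominated-concat fs ds hs)

  module _ {P : List⁺ ℕ → Set} (P? : Decidable P) where

    linked-dropWhile : ∀ f gs → (∀ g → ¬ P g → head f ≤ head g) →
      Linked (λ f g → head f ≤ head g) gs →
      Linked (λ f g → head f ≤ head g) (f ∷ dropWhile P? gs)
    linked-dropWhile f [] _ _ = [-]
    linked-dropWhile f (g ∷ gs) ¬P⇒≤ l with P? g
    ... | no ¬Pg = ¬P⇒≤ g ¬Pg ∷ l
    ... | yes _ with l
    ...   | [-]    = [-]
    ...   | _ ∷ l′ = linked-dropWhile f gs ¬P⇒≤ l′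

    takeWhile-++ : ∀ fs {gs} → All (λ g → ¬ P g) gs →
      takeWhile P? (fs ++ gs) ≡ takeWhile P? fs
    takeWhile-++ [] [] = refl
    takeWhile-++ [] {g ∷ _} (¬Pg ∷ _) with P? g
    ... | yes Pg = contradiction Pg ¬Pg
    ... | no _   = refl
    takeWhile-++ (f ∷ fs) hs with P? f
    ... | yes _ = cong (f ∷_) (takeWhile-++ fs hs)
    ... | no _  = refl

    dropWhile-++ : ∀ fs {gs} → All (λ g → ¬ P g) gs →
      dropWhile P? (fs ++ gs) ≡ dropWhile P? fs ++ gs
    dropWhile-++ [] [] = refl
    dropWhile-++ [] {g ∷ _} (¬Pg ∷ _) with P? g
    ... | yes Pg = contradiction Pg ¬Pg
    ... | no _   = refl
    dropWhile-++ (f ∷ fs) hs with P? f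
    ... | yes _ = dropWhile-++ fs hs
    ... | no _  = refl

    takeWhile-all : ∀ {fs} → All P fs → takeWhile P? fs ≡ fs
    takeWhile-all [] = refl
    takeWhile-all {f ∷ _} (Pf ∷ hs) with P? f
    ... | yes _  = cong (f ∷_) (takeWhile-all hs)
    ... | no ¬Pf = contradiction Pf ¬Pf

    dropWhile-all : ∀ {fs} → All P fs → dropWhile P? fs ≡ []
    dropWhile-all [] = refl
    dropWhile-all {f ∷ _} (Pf ∷ hs) with P? f
    ... | yes _  = dropWhile-all hs
    ... | no ¬Pf = contradiction Pf ¬Pf

  absorb-++ : ∀ x fs {gs} → All (λ g → ¬ head g < x) gs →
    absorb x (fs ++ gs) ≡ absorb x fs ++ gs
  absorb-++ x fs hs = cong₂ (λ fs gs → (x ∷ concatMap toList fs) ∷ gs)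
    (takeWhile-++ (λ f → head f <? x) fs hs)
    (dropWhile-++ (λ f → head f <? x) fs hs)

  absorb-all : ∀ x {fs} → All (λ f → head f < x) fs →
    absorb x fs ≡ (x ∷ concatMap toList fs) ∷ []
  absorb-all x hs = cong₂ (λ fs gs → (x ∷ concatMap toList fs) ∷ gs)
    (takeWhile-all (λ f → head f <? x) hs)
    (dropWhile-all (λ f → head f <? x) hs)

  factorization-++ : ∀ x v {w} → All (_< x) v →
    All (λ f → x ≤ head f) (dominatedFactorization w) →
    dominatedFactorization (v ++ w)
    ≡ dominatedFactorization v ++ dominatedFactorization w
  factorization-++ x [] [] hs = refl
  factorization-++ x (y ∷ v) (y<x ∷ ls) hs =
    trans (cong (absorb y) (factorization-++ x v ls hs))
          (absorb-++ y (dominatedFactorization v)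
            (All.map (λ x≤h → ≤⇒≯ (≤-trans (<⇒≤ y<x) x≤h)) hs))

  heads< : ∀ x v → All (_< x) v →
    All (λ f → head f < x) (dominatedFactorization v)
  heads< x [] [] = []
  heads< x (y ∷ v) (y<x ∷ ls) =
    y<x ∷ All.dropWhile⁺ (λ f → head f <? y) (heads< x v ls)

  product-factorization : ∀ u → concatMap toList (dominatedFactorization u) ≡ u
  product-factorization [] = refl
  product-factorization (x ∷ u) =
    trans (product-absorb x (dominatedFactorization u))
          (cong (x ∷_) (product-factorization u))

isDominatedFactorization : ∀ u →
  IsDominatedFactorization u (dominatedFactorization u)
isDominatedFactorization [] =
  record { product = refl ; dominated = [] ; monotone = [] }
isDominatedFactorization (x ∷ u) = record
  { product   = product-factorization (x ∷ u)
  ; dominated = dominated-concat _ (All.takeWhile⁺ (λ f → head f <? x) dominated)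
                                   (All.all-takeWhile (λ f → head f <? x) fs)
                ∷ All.dropWhile⁺ (λ f → head f <? x) dominated
  ; monotone  = linked-dropWhile (λ f → head f <? x) _ fs (λ _ → ≮⇒≥) monotone
  }
  where
  fs = dominatedFactorization u
  open IsDominatedFactorization (isDominatedFactorization u)

dominatedFactorization-unique : ∀ {u fs} → IsDominatedFactorization u fs →
  fs ≡ dominatedFactorization u
dominatedFactorization-unique isF with IsDominatedFactorization.product isF
... | refl = unique _ dominated (Linked.Linked⇒AllPairs ≤-trans monotone)
  where
  open IsDominatedFactorization isF
  unique : ∀ fs → All InitiallyDominated fs →
    AllPairs.AllPairs (λ f g → head f ≤ head g) fs →
    fs ≡ dominatedFactorization (concatMap toList fs)
  unique [] [] AllPairs.[] = refl
  unique ((x ∷ v) ∷ fs) (d ∷ ds) (h AllPairs.∷ ps) = sym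
    (trans (cong (absorb x) (trans
              (factorization-++ x v d
                 (subst (All (λ f → x ≤ head f)) ih h))
              (cong (dominatedFactorization v ++_) (sym ih))))
    (trans (absorb-++ x (dominatedFactorization v) (All.map ≤⇒≯ h))
           (cong (_++ fs)
             (trans (absorb-all x (heads< x v d))
                    (cong (λ w → (x ∷ w) ∷ []) (product-factorization v))))))
    where ih = unique fs ds ps

------------------------------------------------------------------------
-- Biwords

-- A word in biletters (color, number), colors being the top row. The basis of
-- the algebra of colored free quasi-symmetric functions consists of those
-- whose bottom row is a permutation; the span of all words in biletters also
-- contains the intermediate products in the definition of Ψ below.
Biword : Set
Biword = List (ℕ × ℕ)

_≟ᵇ_ : DecidableEquality Biword
_≟ᵇ_ = ≡-dec (×-≡-dec _≟_ _≟_)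

colors numbers : Biword → Word
colors  = map proj₁
numbers = map proj₂

-- The scalars are an arbitrary commutative ring with a chosen element q; this
-- covers the case where q is an indeterminate.
module BiwordAlgebra {c ℓ} (K : CommutativeRing c ℓ)
                     (q : CommutativeRing.Carrier K) where

  open CommutativeRing K
  open import Algebra.Properties.Semiring.Exp semiring using (_^_)

  -- Formal linear combinations; terms may be repeated, and equality compares
  -- coefficients.
  Formal : Set c
  Formal = List (Carrier × Biword)

  coefficient : Formal → Biword → Carrier
  coefficient []            w = 0#
  coefficient ((a , v) ∷ f) w =
    if does (v ≟ᵇ w) then a + coefficient f w else coefficient f w

  infix 4 _≋_
  _≋_ : Formal → Formal → Set ℓ
  f ≋ g = ∀ w → coefficient f w ≈ coefficient g w

  ⟨_⟩ : Biword → Formal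
  ⟨ w ⟩ = [ (1# , w) ]

  infixr 7 _•_
  _•_ : Carrier → Formal → Formal
  a • f = map (λ (b , w) → (a * b , w)) f

  ∑ : ∀ {a} {A : Set a} → List A → (A → Formal) → Formal
  ∑ xs f = concatMap f xs

  syntax ∑ xs (λ x → f) = ∑[ x ∈ xs ] f

  bilinear : (Biword → Biword → Formal) → Formal → Formal → Formal
  bilinear m f g = ∑[ (a , v) ∈ f ] ∑[ (b , w) ∈ g ] ((a * b) • m v w)

  infixl 8 _·_ _⋆_

  _·_ : Formal → Formal → Formal
  _·_ = bilinear (λ v w → ⟨ v ++ w ⟩)

  -- The product of colored free quasi-symmetric functions.
  _⋆_ : Formal → Formal → Formal
  _⋆_ = bilinear (λ v w →
    ∑[ γ ∈ numbers v ∗ numbers w ] ⟨ zip (colors v ++ colors w) γ ⟩)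

  -- The q-bracket is taken for concatenation, not for _⋆_.
  [_,_]q : Formal → Formal → Formal
  [ f , g ]q = (f · g) ++ ((- q) • (g · f))

  Ψ : List⁺ ℕ → Formal
  Ψ (x ∷ u) =
    foldl (λ B b → [ B , ⟨ [ b ] ⟩ ]q) ⟨ [ (x , 1) ] ⟩
          (zip u (map (2 ℕ.+_) (upTo (length u))))

  𝚿 : Word → Formal
  𝚿 σ = foldr _⋆_ ⟨ [] ⟩ (map Ψ (dominatedFactorization σ))

  -- For compositions I and J of n.
  R : ℕ → List ℕ → List ℕ → Formal
  R n I J =
    ∑[ τ ∈ filter (λ τ → descentComposition τ ≟ʷ I) (𝔖 n) ]
    ∑[ σ ∈ filter (λ σ → saillanceComposition σ ≟ʷ J) (𝔖 n) ]
      ⟨ zip σ τ ⟩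

  coeffIJ : List ℕ → List ℕ → Carrier
  coeffIJ I J =
    if does (Subset._⊆?_ _≟_ (Des I ∖ Des⁻ I) (Des J))
    then (- q) ^ length (Des I ∖ Des J) * (1# - q) ^ length (Des I ∩ Des J)
    else 0#

{-# OPTIONS --safe #-}

-- Compare coefficients at a biword w with colors v and numbers γ. Expanding the q-brackets,
-- the coefficient of Ψ^u is (-q)^k if the numbers fall k times and then rise, and if u lists
-- the colors by increasing number. Hence the coefficient of w on the left is a sum over the
-- ways to cut w into blocks, each one falling to a valley and then rising, such that the color
-- over a valley exceeds all previous colors and all others of its block. Read from left to
-- right, such cuts are counted by a two-state automaton which only sees where γ has a descent
-- and where v has a left-to-right maximum. The latter positions form Des (S v), and solving
-- the recurrences of the automaton gives the product formula for c_IJ.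
module Submission where

open import Defs
open import Algebra.Bundles using (CommutativeRing)
open import Data.Bool.Base using (Bool; true; false; if_then_else_; not; _∨_)
open import Data.List.Base using (List; []; _∷_; _++_; [_]; map; concatMap; foldr; foldl; filter; length; upTo; merge; take; drop; zip)
open import Data.List.Membership.Propositional using (_∈_; _∉_; lose)
open import Data.List.Membership.Propositional.Properties using (∈-map⁺; ∈-map⁻; ∈-filter⁺; ∈-filter⁻; ∈-upTo⁺; ∈-upTo⁻; ∈-cartesianProductWith⁺; ∈-cartesianProductWith⁻; ∈-concatMap⁺; ∈-++⁺ˡ; ∈-++⁺ʳ; ∈-++⁻)
open import Data.List.NonEmpty.Base as List⁺ using (List⁺; _∷_; toList)
open import Data.List.Properties using (≡-dec; map-∘; map-cong-local; length-map; filter-accept; filter-reject; length-filter; filter-some; length-++; map-++; ∷-injective; ++-assoc; take-map; drop-map; take++drop≡id; length-applyUpTo; map-applyUpTo; map-upTo)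
open import Data.List.Relation.Binary.Permutation.Propositional using (_↭_; ↭-refl; ↭-sym; ↭-trans; ↭-reflexive; prep; ↭⇒↭ₛ)
import Data.List.Relation.Binary.Permutation.Propositional.Properties as ↭
import Data.List.Relation.Binary.Permutation.Setoid.Properties as ↭ˢ
open import Data.List.Relation.Binary.Subset.Propositional using (_⊆_)
open import Data.List.Relation.Unary.All as All using (All; []; _∷_)
import Data.List.Relation.Unary.All.Properties as All
open import Data.List.Relation.Unary.AllPairs as AllPairs using (AllPairs; []; _∷_)
import Data.List.Relation.Unary.AllPairs.Properties as AllPairs
open import Data.List.Relation.Unary.Any using (here; there)
open import Data.List.Relation.Unary.Linked as Linked using (Linked; []; [-]; _∷_)
import Data.List.Relation.Unary.Linked.Properties as Linked
open import Data.List.Relation.Unary.Unique.Propositional using (Unique)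
import Data.List.Relation.Unary.Unique.Propositional.Properties as Unique
open import Data.Nat.Base as ℕ using (ℕ; zero; suc; pred; _≤_; _<_; z≤n; s≤s)
open import Data.Nat.ListAction using (sum)
open import Data.Nat.Properties as ℕ using (_≟_; _<?_; _≤?_; ≤-trans; ≤-refl; <-trans; <⇒≢; <⇒≤; m≤n⇒m≤1+n; +-suc; ≤-reflexive; <-cmp; <⇒≱; ≤∧≢⇒<; ≰⇒>; ≮⇒≥; ≤-<-trans; m≤m+n; m≤n+m; suc-injective; ≤-antisym; n≮n; +-monoˡ-≤; +-cancelʳ-≤; m≤n⇒m⊔n≡n; m≥n⇒m⊔n≡m; ⊔-sel; ⊔-lub; m≤m⊔n; m≤n⊔m)
open import Data.Product.Base using (_×_; _,_; proj₁; proj₂; ∃; ∃-syntax; map₁; map₂)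
import Data.Product.Properties as Product
open import Data.Sum.Base using (inj₁; inj₂)
open import Data.Unit.Base using (⊤; tt)
open import Function.Base using (_∘_; id)
open import Function.Bundles using (mk⇔)
open import Level using (Level)
open import Relation.Binary.Definitions using (tri<; tri≈; tri>; Decidable; DecidableEquality)
open import Relation.Binary.PropositionalEquality as ≡ using (_≡_; _≢_)
open import Relation.Nullary using (Dec; yes; no; does; ¬_; contradiction; _×-dec_)
open import Relation.Nullary.Decidable using (does-⇔; dec-true; dec-false; map′; ¬?)
open import Relation.Unary using () renaming (Decidable to Decidable₁)

open import Data.List.Membership.DecPropositional _≟_ using (_∈?_)
open import Data.List.Membership.DecPropositional _≟ʷ_ using () renaming (_∈?_ to _∈ʷ?_)
open import Data.List.Relation.Binary.Subset.DecPropositional _≟_ using (_⊆?_)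

-- The product standardizes both of its factors, so the coefficients of the `Ψ` enter at
-- standardized pieces of `w`. Every condition involved compares numbers by order alone and survives
-- increasing relabelling. The standardizations can therefore be dropped, and all conditions fall on
-- the pieces of `w` themselves.
--
-- Once the blocks and their valleys are fixed, sorting each block by number leaves a single
-- candidate for `σ`. Uniqueness of the dominated factorization then replaces the demand on `σ` by a
-- condition on the blocks, and the sum over `σ` disappears.
--
-- The recurrences of the automaton do not close on the total weight `up + down`: a descent at a
-- non-record leads to `(1 - q)` times `down` alone. If another descent follows, `up` and `down` of
-- the remainder are in the ratio `1 : - q`, which recovers `down` from the total. If none follows,
-- `down` vanishes. Hence the last descent of every run of consecutive descents must sit at a
-- record, which is the condition on `Des I ∖ Des⁻ I`.

module Combinatorics where

  open import Data.Nat.Base using (_+_; _⊔_)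
  open import Relation.Binary.PropositionalEquality using (refl; sym; trans; cong; cong₂; subst; subst₂; setoid)

  -- Permutations and compositions

  Unique-resp-↭ : ∀ {a} {A : Set a} {xs ys : List A} → xs ↭ ys → Unique xs → Unique ys
  Unique-resp-↭ {A = A} p = ↭ˢ.Unique-resp-↭ (setoid A) (↭⇒↭ₛ p)

  ∈-[1⋯]⁺ : ∀ {n x} → 1 ≤ x → x ≤ n → x ∈ [1⋯ n ]
  ∈-[1⋯]⁺ {x = suc x} _ x<n = ∈-map⁺ suc (∈-upTo⁺ x<n)

  ∈-[1⋯]⁻ : ∀ {n x} → x ∈ [1⋯ n ] → 1 ≤ x × x ≤ n
  ∈-[1⋯]⁻ x∈ with ∈-map⁻ suc x∈
  ... | _ , y∈ , refl = s≤s z≤n , ∈-upTo⁻ y∈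

  ∈-words⁺ : ∀ {A w} → All (_∈ A) w → w ∈ words (length w) A
  ∈-words⁺ []         = here refl
  ∈-words⁺ (x∈ ∷ w∈) = ∈-cartesianProductWith⁺ _∷_ x∈ (∈-words⁺ w∈)

  ∈-words⁻ : ∀ k {A w} → w ∈ words k A → length w ≡ k × All (_∈ A) w
  ∈-words⁻ zero    (here refl) = refl , []
  ∈-words⁻ (suc k) {A} w∈ with ∈-cartesianProductWith⁻ _∷_ A (words k A) w∈
  ... | _ , _ , x∈ , v∈ , refl with ∈-words⁻ k v∈
  ...   | l , all = cong suc l , x∈ ∷ all

  words-unique : ∀ k {A} → Unique A → Unique (words k A)
  words-unique zero    u = [] ∷ []
  words-unique (suc k) u =
    Unique.cartesianProductWith⁺ _∷_ (λ { refl → refl , refl }) u (words-unique k u)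

  [1⋯]-unique : ∀ n → Unique [1⋯ n ]
  [1⋯]-unique n = Unique.map⁺ suc-injective (Unique.upTo⁺ n)

  record IsPermutation (n : ℕ) (w : Word) : Set where
    field
      length≡ : length w ≡ n
      letters : All (λ x → 1 ≤ x × x ≤ n) w
      unique  : Unique w

  ∈-𝔖⁺ : ∀ n {w} → IsPermutation n w → w ∈ 𝔖 n
  ∈-𝔖⁺ _ record { length≡ = refl ; letters = ls ; unique = u } =
    ∈-filter⁺ _ (∈-words⁺ (All.map (λ (p , q) → ∈-[1⋯]⁺ p q) ls)) u

  ∈-𝔖⁻ : ∀ n {w} → w ∈ 𝔖 n → IsPermutation n w
  ∈-𝔖⁻ n w∈ with ∈-filter⁻ _ {xs = words n [1⋯ n ]} w∈
  ... | w∈words , u with ∈-words⁻ n w∈words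
  ...   | l , ls = record { length≡ = l ; letters = All.map ∈-[1⋯]⁻ ls ; unique = u }

  𝔖-unique : ∀ n → Unique (𝔖 n)
  𝔖-unique n = Unique.filter⁺ _ (words-unique n ([1⋯]-unique n))

  𝔖-length : ∀ n {w} → w ∈ 𝔖 n → length w ≡ n
  𝔖-length n w∈ = IsPermutation.length≡ (∈-𝔖⁻ n w∈)

  𝔖-resp-↭ : ∀ n {v w} → v ↭ w → v ∈ 𝔖 n → w ∈ 𝔖 n
  𝔖-resp-↭ n p v∈ = ∈-𝔖⁺ n record
    { length≡ = trans (sym (↭.↭-length p)) length≡
    ; letters = ↭.All-resp-↭ p letters
    ; unique  = Unique-resp-↭ p unique
    }
    where open IsPermutation (∈-𝔖⁻ n v∈)

  compositions-unique : ∀ n → Unique (compositions n)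
  compositions-unique n = Unique.filter⁺ (λ I → sum I ≟ n) (Unique.concat⁺
    {xss = map (λ k → words k [1⋯ n ]) (upTo (suc n))}
    (All.map⁺ (All.tabulate {xs = upTo (suc n)} λ {k} _ → words-unique k ([1⋯]-unique n)))
    (AllPairs.map⁺ (AllPairs.map disjoint (Unique.upTo⁺ (suc n)))))
    where
    disjoint : ∀ {j k} → j ≢ k → ∀ {w} → ¬ (w ∈ words j [1⋯ n ] × w ∈ words k [1⋯ n ])
    disjoint {j} {k} j≢k (p , q) =
      j≢k (trans (sym (proj₁ (∈-words⁻ j p))) (proj₁ (∈-words⁻ k q)))

  length-concat⁺ : ∀ (fs : List (List⁺ ℕ)) →
    length (concatMap toList fs) ≡ sum (map List⁺.length fs)
  length-concat⁺ []             = refl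
  length-concat⁺ ((x ∷ w) ∷ fs) =
    cong suc (trans (length-++ w) (cong (length w +_) (length-concat⁺ fs)))

  -- `compositions n` filters words of bounded length over bounded letters, so both bounds are
  -- needed besides the sum. They hold because the factors are nonempty.
  lengths-∈-compositions : ∀ {n} (fs : List (List⁺ ℕ)) → length (concatMap toList fs) ≡ n →
    map List⁺.length fs ∈ compositions n
  lengths-∈-compositions {n} fs refl = ∈-filter⁺ (λ I → sum I ≟ n)
    (∈-concatMap⁺ (λ k → words k [1⋯ n ]) (lose (∈-upTo⁺ (s≤s (parts≤ fs)))
      (subst (λ k → map List⁺.length fs ∈ words k [1⋯ n ]) (length-map _ fs)
        (∈-words⁺ (All.map⁺ (All.tabulate λ f∈ → ∈-[1⋯]⁺ (s≤s z≤n) (part≤ f∈)))))))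
    (sym (length-concat⁺ fs))
    where
    parts≤ : ∀ fs → length fs ≤ length (concatMap toList fs)
    parts≤ []             = z≤n
    parts≤ ((x ∷ w) ∷ fs) = s≤s (≤-trans (parts≤ fs)
      (≤-trans (m≤n+m _ (length w)) (≤-reflexive (sym (length-++ w)))))

    part≤ : ∀ {fs f} → f ∈ fs → List⁺.length f ≤ length (concatMap toList fs)
    part≤ {(x ∷ w) ∷ fs} (here refl) = s≤s (≤-trans (m≤m+n _ _) (≤-reflexive (sym (length-++ w))))
    part≤ {(x ∷ w) ∷ fs} (there f∈)  = ≤-trans (part≤ f∈)
      (m≤n⇒m≤1+n (≤-trans (m≤n+m _ (length w)) (≤-reflexive (sym (length-++ w)))))

  -- Standardization

  rank : Word → ℕ → ℕ
  rank w x = length (filter (_≤? x) w)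

  Monotone : (ℕ → ℕ) → Word → Set
  Monotone h w = ∀ {x y} → x ∈ w → y ∈ w → x < y → h x < h y

  rank-accept : ∀ {x z} w → z ≤ x → rank (z ∷ w) x ≡ suc (rank w x)
  rank-accept {x} w z≤x = cong length (filter-accept (_≤? x) z≤x)

  rank-reject : ∀ {x z} w → ¬ z ≤ x → rank (z ∷ w) x ≡ rank w x
  rank-reject {x} w z≰x = cong length (filter-reject (_≤? x) z≰x)

  -- Every letter counted for `x` is counted for `y`, and `y` itself is counted only for `y`.
  rank-monotone : ∀ w → Monotone (rank w) w
  rank-monotone w {x} {y} _ y∈w x<y = strict w y∈w
    where
    weak : ∀ w → rank w x ≤ rank w y
    weak []      = z≤n
    weak (z ∷ w) with z ≤? x | z ≤? y
    ... | yes z≤x | no z≰y  = contradiction (≤-trans z≤x (<⇒≤ x<y)) z≰y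
    ... | yes z≤x | yes z≤y rewrite rank-accept w z≤x | rank-accept w z≤y = s≤s (weak w)
    ... | no z≰x  | yes z≤y rewrite rank-reject w z≰x | rank-accept w z≤y = m≤n⇒m≤1+n (weak w)
    ... | no z≰x  | no z≰y  rewrite rank-reject w z≰x | rank-reject w z≰y = weak w

    strict : ∀ w → y ∈ w → rank w x < rank w y
    strict (z ∷ w) (here refl)
      rewrite rank-reject w (<⇒≱ x<y) | rank-accept w (≤-refl {y}) = s≤s (weak w)
    strict (z ∷ w) (there y∈) with z ≤? x | z ≤? y
    ... | yes z≤x | no z≰y  = contradiction (≤-trans z≤x (<⇒≤ x<y)) z≰y
    ... | yes z≤x | yes z≤y rewrite rank-accept w z≤x | rank-accept w z≤y = s≤s (strict w y∈)
    ... | no z≰x  | yes z≤y rewrite rank-reject w z≰x | rank-accept w z≤y = m≤n⇒m≤1+n (strict w y∈)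
    ... | no z≰x  | no z≰y  rewrite rank-reject w z≰x | rank-reject w z≰y = strict w y∈

  monotone-≤ : ∀ {h w} → Monotone h w → ∀ {x y} → x ∈ w → y ∈ w → x ≤ y → h x ≤ h y
  monotone-≤ mono {x} {y} x∈ y∈ x≤y with x ≟ y
  ... | yes refl = ≤-refl
  ... | no x≢y   = <⇒≤ (mono x∈ y∈ (≤∧≢⇒< x≤y x≢y))

  monotone-reflects-< : ∀ {h w} → Monotone h w → ∀ {x y} → x ∈ w → y ∈ w → h x < h y → x < y
  monotone-reflects-< mono {x} {y} x∈ y∈ hx<hy with x <? y
  ... | yes x<y = x<y
  ... | no x≮y  = contradiction (monotone-≤ mono y∈ x∈ (≮⇒≥ x≮y)) (<⇒≱ hx<hy)

  -- Ranks depend only on the relative order of letters, which `h` keeps. This is what lets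
  -- standardizations be removed inside products.
  std-map : ∀ {h} w → Monotone h w → std (map h w) ≡ std w
  std-map {h} w mono = trans (sym (map-∘ w))
    (map-cong-local (All.tabulate λ y∈ → rank-map w id y∈))
    where
    rank-map : ∀ v → (∀ {x} → x ∈ v → x ∈ w) → ∀ {y} → y ∈ w → rank (map h v) (h y) ≡ rank v y
    rank-map []      v⊆ y∈ = refl
    rank-map (x ∷ v) v⊆ {y} y∈ with x ≤? y
    ... | yes x≤y = trans (rank-accept (map h v) (monotone-≤ mono (v⊆ (here refl)) y∈ x≤y))
      (trans (cong suc (rank-map v (v⊆ ∘ there) y∈)) (sym (rank-accept v x≤y)))
    ... | no x≰y  = trans (rank-reject (map h v) (<⇒≱ (mono y∈ (v⊆ (here refl)) (≰⇒> x≰y))))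
      (trans (rank-map v (v⊆ ∘ there) y∈) (sym (rank-reject v x≰y)))

  std-∈-𝔖 : ∀ {w} → Unique w → std w ∈ 𝔖 (length w)
  std-∈-𝔖 {w} u = ∈-𝔖⁺ (length w) record
    { length≡ = length-map _ w
    ; letters = All.map⁺ (All.tabulate λ {x} x∈ →
        filter-some (_≤? x) (lose x∈ ≤-refl) , length-filter (_≤? x) w)
    ; unique  = AllPairs.map⁺ (distinct w id u)
    }
    where
    distinct : ∀ v → (∀ {x} → x ∈ v → x ∈ w) → Unique v → AllPairs (λ x y → rank w x ≢ rank w y) v
    distinct []      v⊆ []        = []
    distinct (x ∷ v) v⊆ (x≢ ∷ v!) =
      All.tabulate (λ {y} y∈ → separates (v⊆ (here refl)) (v⊆ (there y∈)) (All.lookup x≢ y∈))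
      ∷ distinct v (v⊆ ∘ there) v!
      where
      separates : ∀ {x y} → x ∈ w → y ∈ w → x ≢ y → rank w x ≢ rank w y
      separates {x} {y} x∈ y∈ x≢y with <-cmp x y
      ... | tri< x<y _ _ = <⇒≢ (rank-monotone w x∈ y∈ x<y)
      ... | tri≈ _ x≡y _ = contradiction x≡y x≢y
      ... | tri> _ _ y<x = <⇒≢ (rank-monotone w y∈ x∈ y<x) ∘ sym

  relabel : (ℕ → ℕ) → Biword → Biword
  relabel h = map (map₂ h)

  colors-relabel : ∀ h z → colors (relabel h z) ≡ colors z
  colors-relabel h z = sym (map-∘ z)

  numbers-relabel : ∀ h z → numbers (relabel h z) ≡ map h (numbers z)
  numbers-relabel h z = trans (sym (map-∘ z)) (map-∘ z)

  stdᵇ : Biword → Biword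
  stdᵇ z = relabel (rank (numbers z)) z

  biword-ext : ∀ {y z : Biword} → colors y ≡ colors z → numbers y ≡ numbers z → y ≡ z
  biword-ext {[]}    {[]}    _ _ = refl
  biword-ext {_ ∷ _} {_ ∷ _} p q with refl , p′ ← ∷-injective p | refl , q′ ← ∷-injective q =
    cong (_ ∷_) (biword-ext p′ q′)

  numbers-stdᵇ : ∀ z → numbers (stdᵇ z) ≡ std (numbers z)
  numbers-stdᵇ z = numbers-relabel _ z

  colors-stdᵇ : ∀ z → colors (stdᵇ z) ≡ colors z
  colors-stdᵇ z = colors-relabel _ z

  stdᵇ-relabel : ∀ {h} z → Monotone h (numbers z) → stdᵇ (relabel h z) ≡ stdᵇ z
  stdᵇ-relabel {h} z mono = biword-ext
    (trans (colors-stdᵇ (relabel h z)) (trans (colors-relabel h z) (sym (colors-stdᵇ z))))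
    (trans (numbers-stdᵇ (relabel h z))
      (trans (cong std (numbers-relabel h z))
          (trans (std-map (numbers z) mono) (sym (numbers-stdᵇ z)))))

  -- Increasing words, merging

  infix 4 _≺_ _≺?_
  _≺_ : ℕ × ℕ → ℕ × ℕ → Set
  x ≺ y = proj₂ x < proj₂ y

  -- Opaque, since unfolding to _<ᵇ_ would prevent abstraction over x ≺? y.
  opaque
    _≺?_ : Decidable _≺_
    x ≺? y = proj₂ x <? proj₂ y

  Increasing : Biword → Set
  Increasing = Linked _≺_

  increasing? : ∀ w → Dec (Increasing w)
  increasing? = Linked.linked? _≺?_

  merge≺ : Biword → Biword → Biword
  merge≺ = merge _≺?_

  merge≺-↭ : ∀ l r → merge≺ l r ↭ l ++ r
  merge≺-↭ = ↭.merge-↭ _≺?_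

  merge≺-[]ʳ : ∀ l → merge≺ l [] ≡ l
  merge≺-[]ʳ []      = refl
  merge≺-[]ʳ (_ ∷ _) = refl

  increasing-merge⁻ : ∀ x l r → Increasing (x ∷ merge≺ l r) → Increasing (x ∷ l) × Increasing (x ∷ r)
  increasing-merge⁻ x []      r       inc = [-] , inc
  increasing-merge⁻ x (y ∷ l) []      inc = inc , [-]
  increasing-merge⁻ x (y ∷ l) (z ∷ r) inc with y ≺? z
  increasing-merge⁻ x (y ∷ l) (z ∷ r) (x≺y ∷ inc) | yes y≺z =
    let incˡ , incʳ = increasing-merge⁻ y l (z ∷ r) inc
    in x≺y ∷ incˡ , <-trans x≺y y≺z ∷ Linked.tail incʳ
  increasing-merge⁻ x (y ∷ l) (z ∷ r) (x≺z ∷ inc) | no _ =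
    let incˡ , incʳ = increasing-merge⁻ z (y ∷ l) r inc
    in <-trans x≺z (Linked.head incˡ) ∷ Linked.tail incˡ , x≺z ∷ incʳ

  -- A tie would break strictness; since numbers of `l` and `r` differ, the failure of `y ≺ z` gives
  -- `z ≺ y`.
  increasing-merge⁺ : ∀ x l r → (∀ {y z} → y ∈ l → z ∈ r → proj₂ y ≢ proj₂ z) →
    Increasing (x ∷ l) → Increasing (x ∷ r) → Increasing (x ∷ merge≺ l r)
  increasing-merge⁺ x []      r       _ _    incʳ = incʳ
  increasing-merge⁺ x (y ∷ l) []      _ incˡ _    = incˡ
  increasing-merge⁺ x (y ∷ l) (z ∷ r) ≢ (x≺y ∷ incˡ) (x≺z ∷ incʳ)
    with y ≺? z | increasing-merge⁺ y l (z ∷ r) | increasing-merge⁺ z (y ∷ l) r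
  ... | yes y≺z | rec | _   = x≺y ∷ rec (≢ ∘ there) incˡ (y≺z ∷ incʳ)
  ... | no y⊀z  | _   | rec = x≺z ∷ rec (λ y∈ → ≢ y∈ ∘ there)
      (≤∧≢⇒< (≮⇒≥ y⊀z) (≢ (here refl) (here refl) ∘ sym) ∷ incˡ) incʳ

  relabel-merge : ∀ {h w} → Monotone h w → ∀ l r →
    All (λ y → proj₂ y ∈ w) l → All (λ y → proj₂ y ∈ w) r →
    merge≺ (relabel h l) (relabel h r) ≡ relabel h (merge≺ l r)
  relabel-merge mono []      r       _ _ = refl
  relabel-merge mono (y ∷ l) []      _ _ = refl
  relabel-merge {h} mono (y ∷ l) (z ∷ r) (y∈ ∷ l∈) (z∈ ∷ r∈)
    with map₂ h y ≺? map₂ h z | y ≺? z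
       | relabel-merge mono l (z ∷ r) l∈ (z∈ ∷ r∈) | relabel-merge mono (y ∷ l) r (y∈ ∷ l∈) r∈
  ... | yes _   | yes _   | rec | _   = cong (map₂ h y ∷_) rec
  ... | no _    | no _    | _   | rec = cong (map₂ h z ∷_) rec
  ... | yes h<  | no y⊀z  | _   | _   = contradiction (monotone-reflects-< mono y∈ z∈ h<) y⊀z
  ... | no h≮   | yes y≺z | _   | _   = contradiction (mono y∈ z∈ y≺z) h≮

  relabel-increasing⁻ : ∀ {h w} → Monotone h w → ∀ {z} → All (λ y → proj₂ y ∈ w) z →
    Increasing (relabel h z) → Increasing z
  relabel-increasing⁻ mono []            _           = []
  relabel-increasing⁻ mono (_ ∷ [])      _           = [-]
  relabel-increasing⁻ mono (x∈ ∷ y∈ ∷ z∈) (h< ∷ inc) =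
    monotone-reflects-< mono x∈ y∈ h< ∷ relabel-increasing⁻ mono (y∈ ∷ z∈) inc

  relabel-increasing⁺ : ∀ {h w} → Monotone h w → ∀ {z} → All (λ y → proj₂ y ∈ w) z →
    Increasing z → Increasing (relabel h z)
  relabel-increasing⁺ mono []            _           = []
  relabel-increasing⁺ mono (_ ∷ [])      _           = [-]
  relabel-increasing⁺ mono (x∈ ∷ y∈ ∷ z∈) (x≺y ∷ inc) =
    mono x∈ y∈ x≺y ∷ relabel-increasing⁺ mono (y∈ ∷ z∈) inc

  increasing-bound : ∀ x w {m} → Linked _<_ (x ∷ w) → All (_≤ m) (x ∷ w) → x + length w ≤ m
  increasing-bound x []      _           (x≤m ∷ _) = ≤-trans (≤-reflexive (ℕ.+-identityʳ x)) x≤m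
  increasing-bound x (y ∷ w) (x<y ∷ inc) (_ ∷ w≤m) = ≤-trans (≤-reflexive (+-suc x (length w)))
    (≤-trans (+-monoˡ-≤ (length w) x<y) (increasing-bound y w inc w≤m))

  -- The `length w` larger letters after `x` leave no room for `x` above `suc k`.
  increasing-head : ∀ k x w → Linked _<_ (x ∷ w) → All (k <_) (x ∷ w) →
    All (_≤ k + suc (length w)) (x ∷ w) → x ≡ suc k
  increasing-head k x w inc (k<x ∷ _) w≤ = ≤-antisym (+-cancelʳ-≤ (length w) x (suc k)
    (≤-trans (increasing-bound x w inc w≤) (≤-reflexive (+-suc k (length w))))) k<x

  -- The only increasing word of length n over {k + 1, …, k + n} is (k + 1) ⋯ (k + n).
  increasing-unique : ∀ k v w → length v ≡ length w → Linked _<_ v → Linked _<_ w →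
    All (k <_) v → All (_≤ k + length v) v → All (k <_) w → All (_≤ k + length v) w → v ≡ w
  increasing-unique k []      []      _   _    _    _ _ _ _ = refl
  increasing-unique k (x ∷ v) (y ∷ w) len incᵛ incʷ v> v≤ w> w≤
    with refl ← increasing-head k x v incᵛ v> v≤
       | refl ← increasing-head k y w incʷ w> (subst (λ n → All (_≤ k + n) (y ∷ w)) len w≤)
    = cong (suc k ∷_) (increasing-unique (suc k) v w (suc-injective len) (Linked.tail incᵛ)
        (Linked.tail incʷ) (above incᵛ) (bound v≤) (above incʷ) (bound w≤))
    where
    bound : ∀ {n u} → All (_≤ k + suc n) (suc k ∷ u) → All (_≤ suc k + n) u
    bound (_ ∷ u≤) = All.map (λ x≤ → ≤-trans x≤ (≤-reflexive (+-suc k _))) u≤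

    above : ∀ {x u} → Linked _<_ (x ∷ u) → All (x <_) u
    above inc = AllPairs.head (Linked.Linked⇒AllPairs <-trans inc)

  -- Cutting biwords into blocks

  splits : Biword → List (Biword × Biword)
  splits []      = [ ([] , []) ]
  splits (x ∷ z) = ([] , x ∷ z) ∷ map (map₁ (x ∷_)) (splits z)

  ++-splits : ∀ z {u v} → (u , v) ∈ splits z → u ++ v ≡ z
  ++-splits []      (here refl) = refl
  ++-splits (x ∷ z) (here refl) = refl
  ++-splits (x ∷ z) (there uv∈) with ∈-map⁻ (map₁ (x ∷_)) uv∈
  ... | _ , uv∈′ , refl = cong (x ∷_) (++-splits z uv∈′)

  splits-relabel : ∀ h z → splits (relabel h z) ≡ map (λ (u , v) → relabel h u , relabel h v) (splits z)
  splits-relabel h []      = refl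
  splits-relabel h (x ∷ z) = cong (([] , relabel h (x ∷ z)) ∷_)
    (trans (cong (map _) (splits-relabel h z)) (trans (sym (map-∘ (splits z))) (map-∘ (splits z))))

  -- A block (l , x , r) stands for the word l x r, with l read from right to left.
  Block : Set
  Block = Biword × (ℕ × ℕ) × Biword

  relabelᵇ : (ℕ → ℕ) → Block → Block
  relabelᵇ h (l , x , r) = relabel h l , map₂ h x , relabel h r

  zippers : Biword → Biword → List Block
  zippers l []      = []
  zippers l (x ∷ z) = (l , x , z) ∷ zippers (x ∷ l) z

  zippers-↭ : ∀ l₀ z {l x r} → (l , x , r) ∈ zippers l₀ z → x ∷ l ++ r ↭ l₀ ++ z
  zippers-↭ l₀ (x ∷ z) (here refl) = ↭-sym (↭.shift x l₀ z)
  zippers-↭ l₀ (x ∷ z) (there b∈)  = ↭-trans (zippers-↭ (x ∷ l₀) z b∈) (↭-sym (↭.shift x l₀ z))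

  zippers-relabel : ∀ h l z → zippers (relabel h l) (relabel h z) ≡ map (relabelᵇ h) (zippers l z)
  zippers-relabel h l []      = refl
  zippers-relabel h l (x ∷ z) = cong (relabelᵇ h (l , x , z) ∷_) (zippers-relabel h (x ∷ l) z)

  mutual
    -- `l` collects the letters of a block whose valley is still to come; without a valley the block
    -- is lost, hence the empty list at the end of the word. No order or color condition is imposed
    -- here: all cuts and all choices of valleys are listed, and validity enters through the
    -- weights.
    descending : Biword → Biword → List (List Block)
    descending l []      = []
    descending l (x ∷ z) = map (λ (r , bs) → (l , x , r) ∷ bs) (ascending z) ++ descending (x ∷ l) z

    ascending : Biword → List (Biword × List Block)
    ascending []      = [ ([] , []) ]
    ascending (y ∷ z) =
      map ([] ,_) (descending [] (y ∷ z)) ++ map (map₁ (y ∷_)) (ascending z)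

  -- The empty word has the empty blocking, which `descending` would miss because it has already
  -- begun a block.
  blockings : Biword → List (List Block)
  blockings []          = [ [] ]
  blockings z@(_ ∷ _) = descending [] z

  -- If the block falls to `x` and then rises, with distinct numbers, this is the block by
  -- increasing number. Its colors then spell the word `u` whose `Ψ` contains the standardized
  -- block.
  sorted : Block → List⁺ (ℕ × ℕ)
  sorted (l , x , r) = x ∷ merge≺ l r

  letters : List Block → Biword
  letters = concatMap (toList ∘ sorted)

  letters-↭ : ∀ l x r bs → letters ((l , x , r) ∷ bs) ↭ x ∷ l ++ (r ++ letters bs)
  letters-↭ l x r bs = prep x (↭-trans (↭.++⁺ʳ (letters bs) (merge≺-↭ l r))
    (↭-reflexive (++-assoc l r (letters bs))))

  mutual
    descending-↭ : ∀ l z {bs} → bs ∈ descending l z → letters bs ↭ l ++ z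
    descending-↭ l (x ∷ z) bs∈ with ∈-++⁻ (map (λ (r , bs) → (l , x , r) ∷ bs) (ascending z)) bs∈
    ... | inj₂ bs∈′ = ↭-trans (descending-↭ (x ∷ l) z bs∈′) (↭-sym (↭.shift x l z))
    ... | inj₁ bs∈′ with ∈-map⁻ _ bs∈′
    ...   | (r , bs) , rbs∈ , refl = ↭-trans (letters-↭ l x r bs)
      (↭-trans (prep x (↭.++⁺ˡ l (ascending-↭ z rbs∈))) (↭-sym (↭.shift x l z)))

    ascending-↭ : ∀ z {r bs} → (r , bs) ∈ ascending z → r ++ letters bs ↭ z
    ascending-↭ []      (here refl) = ↭-refl
    ascending-↭ (y ∷ z) rbs∈ with ∈-++⁻ (map ([] ,_) (descending [] (y ∷ z))) rbs∈
    ... | inj₁ rbs∈′ with ∈-map⁻ ([] ,_) rbs∈′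
    ...   | bs , bs∈ , refl = descending-↭ [] (y ∷ z) bs∈
    ascending-↭ (y ∷ z) rbs∈ | inj₂ rbs∈′ with ∈-map⁻ (map₁ (y ∷_)) rbs∈′
    ...   | (r , bs) , rbs∈″ , refl = prep y (ascending-↭ z rbs∈″)

  blockings-↭ : ∀ z {bs} → bs ∈ blockings z → letters bs ↭ z
  blockings-↭ []      (here refl) = ↭-refl
  blockings-↭ (x ∷ z) bs∈         = descending-↭ [] (x ∷ z) bs∈

  -- Descent and saillance sets

  -- The first letter of a word carries no flag, so the flag at the second letter has position 1,
  -- matching the indexing of descents.
  positions : List Bool → List ℕ
  positions []           = []
  positions (true ∷ bs)  = 1 ∷ map suc (positions bs)
  positions (false ∷ bs) = map suc (positions bs)

  Des-suc : ∀ i I → Des (suc i ∷ I) ≡ map suc (Des (i ∷ I))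
  Des-suc i []      = refl
  Des-suc i (j ∷ I) = cong (suc i ∷_) (map-∘ (Des (j ∷ I)))

  descents : ℕ → Word → List Bool
  descents t []      = []
  descents t (s ∷ γ) = not (does (t <? s)) ∷ descents s γ

  -- A tie counts as a record, since a dominated factor admits only letters strictly below its head.
  records : ℕ → Word → List Bool
  records m []      = []
  records m (x ∷ v) = does (m ≤? x) ∷ records (m ⊔ x) v

  prepend-∷ : ∀ x fs → ∃[ w ] ∃[ gs ] prepend x fs ≡ (x ∷ w) ∷ gs
  prepend-∷ x []             = [] , [] , refl
  prepend-∷ x ((y ∷ w) ∷ fs) with does (x <? y)
  ... | true  = y ∷ w , fs , refl
  ... | false = [] , (y ∷ w) ∷ fs , refl

  Des-descentComposition : ∀ t γ → Des (descentComposition (t ∷ γ)) ≡ positions (descents t γ)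
  Des-descentComposition t []      = refl
  Des-descentComposition t (s ∷ γ)
    with increasingFactors (s ∷ γ) | prepend-∷ s (increasingFactors γ) | Des-descentComposition s γ
  ... | _ | w , gs , refl | ih with does (t <? s)
  ...   | true  = trans (Des-suc (suc (length w)) (map List⁺.length gs)) (cong (map suc) ih)
  ...   | false = cong ((1 ∷_) ∘ map suc) ih

  concat-prepend : ∀ x fs → concatMap toList (prepend x fs) ≡ x ∷ concatMap toList fs
  concat-prepend x []             = refl
  concat-prepend x ((y ∷ w) ∷ fs) with does (x <? y)
  ... | true  = refl
  ... | false = refl

  concat-increasingFactors : ∀ γ → concatMap toList (increasingFactors γ) ≡ γ
  concat-increasingFactors []      = refl
  concat-increasingFactors (x ∷ γ) =
    trans (concat-prepend x (increasingFactors γ)) (cong (x ∷_) (concat-increasingFactors γ))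

  -- Inside a factor the running maximum stays at its head, and the next head is at least as large.
  -- The records after `x` are thus the heads of the later factors.
  Des-records : ∀ x w fs → All InitiallyDominated ((x ∷ w) ∷ fs) →
    Linked (λ f g → List⁺.head f ≤ List⁺.head g) ((x ∷ w) ∷ fs) →
    positions (records x (w ++ concatMap toList fs)) ≡ Des (map List⁺.length ((x ∷ w) ∷ fs))
  Des-records x [] []             _ _ = refl
  Des-records x [] ((y ∷ v) ∷ fs) (_ ∷ dom) (x≤y ∷ mono)
    rewrite dec-true (x ≤? y) x≤y | m≤n⇒m⊔n≡n x≤y =
        cong ((1 ∷_) ∘ map suc) (Des-records y v fs dom mono)
  Des-records x (y ∷ w) fs ((y<x ∷ w<x) ∷ dom) mono
    rewrite dec-false (x ≤? y) (<⇒≱ y<x) | m≥n⇒m⊔n≡m (<⇒≤ y<x) =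
    trans (cong (map suc) (Des-records x w fs (w<x ∷ dom) (retail mono)))
          (sym (Des-suc (suc (length w)) (map List⁺.length fs)))
    where
    retail : ∀ {fs} → Linked (λ f g → List⁺.head f ≤ List⁺.head g) ((x ∷ y ∷ w) ∷ fs) →
      Linked (λ f g → List⁺.head f ≤ List⁺.head g) ((x ∷ w) ∷ fs)
    retail [-]      = [-]
    retail (p ∷ ps) = p ∷ ps

  Des-saillanceComposition : ∀ x v → Des (saillanceComposition (x ∷ v)) ≡ positions (records x v)
  Des-saillanceComposition x v = trans
    (sym (Des-records x _ _ dominated monotone))
    (cong (positions ∘ records x) (proj₂ (∷-injective product)))
    where open IsDominatedFactorization (isDominatedFactorization (x ∷ v))

  0∉positions : ∀ bs → 0 ∉ positions bs
  0∉positions (true ∷ bs)  (there 0∈) with () ← proj₂ (proj₂ (∈-map⁻ suc 0∈))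
  0∉positions (false ∷ bs) 0∈         with () ← proj₂ (proj₂ (∈-map⁻ suc 0∈))

  suc-∈-positions⁺ : ∀ b bs {x} → x ∈ positions bs → suc x ∈ positions (b ∷ bs)
  suc-∈-positions⁺ true  bs x∈ = there (∈-map⁺ suc x∈)
  suc-∈-positions⁺ false bs x∈ = ∈-map⁺ suc x∈

  suc-∈-positions⁻ : ∀ b bs {x} → 1 ≤ x → suc x ∈ positions (b ∷ bs) → x ∈ positions bs
  suc-∈-positions⁻ true  bs 1≤x (here refl) = contradiction 1≤x (λ ())
  suc-∈-positions⁻ true  bs _   (there x∈) with ∈-map⁻ suc x∈
  ... | _ , x∈′ , refl = x∈′
  suc-∈-positions⁻ false bs _   x∈ with ∈-map⁻ suc x∈
  ... | _ , x∈′ , refl = x∈′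

  1∉positions : ∀ bs → 1 ∉ positions (false ∷ bs)
  1∉positions bs 1∈ with ∈-map⁻ suc 1∈
  ... | _ , 0∈ , refl = 0∉positions bs 0∈

  -- Valid blockings and dominated factorizations

  colorsᵇ : Block → List⁺ ℕ
  colorsᵇ = List⁺.map proj₁ ∘ sorted

  Valley : Block → Set
  Valley (l , x , r) = Increasing (x ∷ l) × Increasing (x ∷ r)

  valley? : Decidable₁ Valley
  valley? (l , x , r) = increasing? (x ∷ l) ×-dec increasing? (x ∷ r)

  Dominates : ℕ × ℕ → Biword → Set
  Dominates x w = All (λ y → proj₁ y < proj₁ x) w

  -- `m` is the color over the preceding valley. Through the earlier conditions it bounds all
  -- earlier colors, so comparing neighbouring valleys suffices.
  ValidLeft : ℕ → Biword → ℕ × ℕ → Set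
  ValidLeft m l x = Increasing (x ∷ l) × Dominates x l × m ≤ proj₁ x

  validLeft? : ∀ m l x → Dec (ValidLeft m l x)
  validLeft? m l x = increasing? (x ∷ l) ×-dec All.all? (λ y → proj₁ y <? proj₁ x) l ×-dec m ≤? proj₁ x

  ValidRight : ℕ × ℕ → Biword → Set
  ValidRight x r = Increasing (x ∷ r) × Dominates x r

  validRight? : ∀ x r → Dec (ValidRight x r)
  validRight? x r = increasing? (x ∷ r) ×-dec All.all? (λ y → proj₁ y <? proj₁ x) r

  Valid : ℕ → List Block → Set
  Valid m []                 = ⊤
  Valid m ((l , x , r) ∷ bs) = ValidLeft m l x × ValidRight x r × Valid (proj₁ x) bs

  valid? : ∀ m bs → Dec (Valid m bs)
  valid? m []                 = yes tt
  valid? m ((l , x , r) ∷ bs) = validLeft? m l x ×-dec validRight? x r ×-dec valid? (proj₁ x) bs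

  concat-colorsᵇ : ∀ bs → concatMap toList (map colorsᵇ bs) ≡ colors (letters bs)
  concat-colorsᵇ []                 = refl
  concat-colorsᵇ ((l , x , r) ∷ bs) = cong (proj₁ x ∷_)
    (trans (cong (colors (merge≺ l r) ++_) (concat-colorsᵇ bs))
           (sym (map-++ proj₁ (merge≺ l r) (letters bs))))

  dominated⁺ : ∀ l x r → Dominates x l → Dominates x r → InitiallyDominated (colorsᵇ (l , x , r))
  dominated⁺ l x r l< r< = All.map⁺ (↭.All-resp-↭ (↭-sym (merge≺-↭ l r)) (All.++⁺ l< r<))

  dominated⁻ : ∀ l x r → InitiallyDominated (colorsᵇ (l , x , r)) → Dominates x l × Dominates x r
  dominated⁻ l x r w< = All.++⁻ l (↭.All-resp-↭ (merge≺-↭ l r) (All.map⁻ w<))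

  _≤ʰ_ : List⁺ ℕ → List⁺ ℕ → Set
  f ≤ʰ g = List⁺.head f ≤ List⁺.head g

  -- The fictitious factor `m ∷ []` in front turns the comparison with the preceding valley into one
  -- more link.
  valid⁺ : ∀ m bs → All Valley bs → All InitiallyDominated (map colorsᵇ bs) →
    Linked _≤ʰ_ ((m ∷ []) ∷ map colorsᵇ bs) → Valid m bs
  valid⁺ m []                 _ _ _ = tt
  valid⁺ m ((l , x , r) ∷ bs) ((incˡ , incʳ) ∷ vs) (d ∷ ds) (m≤ ∷ mono) =
    let l< , r< = dominated⁻ l x r d
    in (incˡ , l< , m≤) , (incʳ , r<) , valid⁺ (proj₁ x) bs vs ds (rehead mono)
    where
    rehead : ∀ {x v w fs} → Linked _≤ʰ_ ((x ∷ v) ∷ fs) → Linked _≤ʰ_ ((x ∷ w) ∷ fs)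
    rehead [-]      = [-]
    rehead (p ∷ ps) = p ∷ ps

  valid⁻ : ∀ m bs → Valid m bs →
      All Valley bs × All InitiallyDominated (map colorsᵇ bs) × Linked _≤ʰ_ (map colorsᵇ bs)
  valid⁻ m [] _ = [] , [] , []
  valid⁻ m ((l , x , r) ∷ bs) ((incˡ , l< , _) , (incʳ , r<) , v) =
    let vs , ds , mono = valid⁻ (proj₁ x) bs v
    in (incˡ , incʳ) ∷ vs , dominated⁺ l x r l< r< ∷ ds , link bs v mono
    where
    link : ∀ bs → Valid (proj₁ x) bs → Linked _≤ʰ_ (map colorsᵇ bs) →
      Linked _≤ʰ_ (colorsᵇ (l , x , r) ∷ map colorsᵇ bs)
    link []       _                    _    = [-]
    link (b ∷ bs) ((_ , _ , x≤) , _)   mono = x≤ ∷ mono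

  -- With its converse, this trades the demand on the factorization of `σ` for a formula for `σ` and
  -- a condition on the blocking alone. The start `0` makes the first comparison vacuous.
  factorization⇒valid : ∀ bs {σ} → All Valley bs × dominatedFactorization σ ≡ map colorsᵇ bs →
    σ ≡ colors (letters bs) × Valid 0 bs
  factorization⇒valid bs {σ} (vs , eq) =
    trans (sym (IsDominatedFactorization.product isF))
        (trans (cong (concatMap toList) eq) (concat-colorsᵇ bs)) ,
    valid⁺ 0 bs vs (subst (All InitiallyDominated) eq (IsDominatedFactorization.dominated isF))
      (start (subst (Linked _≤ʰ_) eq (IsDominatedFactorization.monotone isF)))
    where
    isF = isDominatedFactorization σ
    start : ∀ {fs} → Linked _≤ʰ_ fs → Linked _≤ʰ_ ((0 ∷ []) ∷ fs)
    start {[]}    _  = [-]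
    start {_ ∷ _} ps = z≤n ∷ ps

  valid⇒factorization : ∀ bs {σ} → σ ≡ colors (letters bs) × Valid 0 bs →
    All Valley bs × dominatedFactorization σ ≡ map colorsᵇ bs
  valid⇒factorization bs (refl , v) =
    let vs , ds , mono = valid⁻ 0 bs v
    in vs , sym (dominatedFactorization-unique (record
      { product = concat-colorsᵇ bs ; dominated = ds ; monotone = mono }))

  -- Membership conditions on descent sets

  length-filter-map : ∀ {a b p q} {A : Set a} {B : Set b} {P : B → Set p} {Q : A → Set q}
    (P? : Decidable₁ P) (Q? : Decidable₁ Q) (f : A → B) xs →
    (∀ {x} → x ∈ xs → (P (f x) → Q x) × (Q x → P (f x))) →
    length (filter P? (map f xs)) ≡ length (filter Q? xs)
  length-filter-map P? Q? f []       _ = refl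
  length-filter-map P? Q? f (x ∷ xs) P⇔Q with P? (f x) | Q? x
  ... | yes _  | yes _  = cong suc (length-filter-map P? Q? f xs (P⇔Q ∘ there))
  ... | no _   | no _   = length-filter-map P? Q? f xs (P⇔Q ∘ there)
  ... | yes px | no ¬qx = contradiction (proj₁ (P⇔Q (here refl)) px) ¬qx
  ... | no ¬px | yes qx = contradiction (proj₂ (P⇔Q (here refl)) qx) ¬px

  positive : ∀ bs {x} → x ∈ positions bs → 1 ≤ x
  positive bs {zero}  0∈ = contradiction 0∈ (0∉positions bs)
  positive bs {suc x} _  = s≤s z≤n

  -- The flag `b` can only add position 1, which is not the successor of a position; all other
  -- positions are shifted alike.
  length-∖ : ∀ b ds es → length (map suc (positions ds) ∖ positions (b ∷ es))
      ≡ length (positions ds ∖ positions es)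
  length-∖ b ds es = length-filter-map
    (λ x → ¬? (x ∈? positions (b ∷ es))) (λ x → ¬? (x ∈? positions es)) suc (positions ds)
    λ x∈ → (λ ∉E → ∉E ∘ suc-∈-positions⁺ b es) ,
           (λ ∉E → ∉E ∘ suc-∈-positions⁻ b es (positive ds x∈))

  length-∩ : ∀ b ds es → length (map suc (positions ds) ∩ positions (b ∷ es))
      ≡ length (positions ds ∩ positions es)
  length-∩ b ds es = length-filter-map
    (λ x → x ∈? positions (b ∷ es)) (λ x → x ∈? positions es) suc (positions ds)
    λ x∈ → suc-∈-positions⁻ b es (positive ds x∈) , suc-∈-positions⁺ b es

  length-∖-accept : ∀ {x} A B → x ∉ B → length ((x ∷ A) ∖ B) ≡ suc (length (A ∖ B))
  length-∖-accept A B x∉ = cong length (filter-accept (λ x → ¬? (x ∈? B)) {xs = A} x∉)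

  length-∖-reject : ∀ {x} A B → x ∈ B → length ((x ∷ A) ∖ B) ≡ length (A ∖ B)
  length-∖-reject A B x∈ = cong length (filter-reject (λ x → ¬? (x ∈? B)) {xs = A} (λ x∉ → x∉ x∈))

  length-∩-accept : ∀ {x} A B → x ∈ B → length ((x ∷ A) ∩ B) ≡ suc (length (A ∩ B))
  length-∩-accept A B x∈ = cong length (filter-accept (λ x → x ∈? B) {xs = A} x∈)

  length-∩-reject : ∀ {x} A B → x ∉ B → length ((x ∷ A) ∩ B) ≡ length (A ∩ B)
  length-∩-reject A B x∉ = cong length (filter-reject (λ x → x ∈? B) {xs = A} x∉)

  -- A form of `(D ∖ map pred D) ⊆ E` that avoids predecessors and so is compatible with shifting
  -- all positions by one.
  PeaksIn : List ℕ → List ℕ → Set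
  PeaksIn D E = ∀ {x} → x ∈ D → suc x ∉ D → x ∈ E

  ∖-pred⇒peaks : ∀ bs {E} → (positions bs ∖ map pred (positions bs)) ⊆ E → PeaksIn (positions bs) E
  ∖-pred⇒peaks bs {E} sub {x} x∈ sx∉ =
    sub (∈-filter⁺ (λ y → ¬? (y ∈? map pred (positions bs))) x∈ (absurd ∘ ∈-map⁻ pred))
    where
    absurd : ∃ (λ y → y ∈ positions bs × x ≡ pred y) → _
    -- `pred 0` is `0`, so only here could a member of `map pred` fail to be a true predecessor.
    absurd (zero  , 0∈ , _)    = 0∉positions bs 0∈
    absurd (suc y , y∈ , refl) = sx∉ y∈

  peaks⇒∖-pred : ∀ D {E} → PeaksIn D E → (D ∖ map pred D) ⊆ E
  peaks⇒∖-pred D peaks x∈ =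
    let x∈D , x∉ = ∈-filter⁻ (λ y → ¬? (y ∈? map pred D)) {xs = D} x∈
    in peaks x∈D (x∉ ∘ ∈-map⁺ pred)

  peaks-tail : ∀ b b′ ds es → PeaksIn (positions (b ∷ ds)) (positions (b′ ∷ es)) →
      PeaksIn (positions ds) (positions es)
  peaks-tail b b′ ds es peaks x∈ sx∉ = suc-∈-positions⁻ b′ es (positive ds x∈)
    (peaks (suc-∈-positions⁺ b ds x∈) (sx∉ ∘ suc-∈-positions⁻ b ds (s≤s z≤n)))

  peaks-cons : ∀ b b′ ds es → (1 ∈ positions (b ∷ ds) → 1 ∉ positions ds → 1 ∈ positions (b′ ∷ es)) →
    PeaksIn (positions ds) (positions es) → PeaksIn (positions (b ∷ ds)) (positions (b′ ∷ es))
  peaks-cons b b′ ds es first peaks {zero}        0∈ _   = contradiction 0∈ (0∉positions (b ∷ ds))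
  peaks-cons b b′ ds es first peaks {suc zero}    1∈ 2∉  = first 1∈ (2∉ ∘ suc-∈-positions⁺ b ds)
  peaks-cons b b′ ds es first peaks {suc (suc x)} x∈ sx∉ = suc-∈-positions⁺ b′ es
    (peaks (suc-∈-positions⁻ b ds (s≤s z≤n) x∈) (sx∉ ∘ suc-∈-positions⁺ b ds))

  -- Biletters of `Ψ` and standardized blocks

  take-++ : ∀ {a} {A : Set a} (xs ys : List A) → take (length xs) (xs ++ ys) ≡ xs
  take-++ []       ys = refl
  take-++ (x ∷ xs) ys = cong (x ∷_) (take-++ xs ys)

  drop-++ : ∀ {a} {A : Set a} (xs ys : List A) → drop (length xs) (xs ++ ys) ≡ ys
  drop-++ []       ys = refl
  drop-++ (x ∷ xs) ys = drop-++ xs ys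

  stdᵇ-length : ∀ z → length (stdᵇ z) ≡ length z
  stdᵇ-length z = length-map _ z

  zip-colors-numbers : ∀ z → zip (colors z) (numbers z) ≡ z
  zip-colors-numbers []      = refl
  zip-colors-numbers (x ∷ z) = cong (x ∷_) (zip-colors-numbers z)

  colors-zip : ∀ v w → length v ≡ length w → colors (zip v w) ≡ v
  colors-zip []      []      _   = refl
  colors-zip (x ∷ v) (y ∷ w) len = cong (x ∷_) (colors-zip v w (suc-injective len))

  numbers-zip : ∀ v w → length v ≡ length w → numbers (zip v w) ≡ w
  numbers-zip []      []      _   = refl
  numbers-zip (x ∷ v) (y ∷ w) len = cong (y ∷_) (numbers-zip v w (suc-injective len))

  infix 4 _≟ˡ_ _≟⁺_
  _≟ˡ_ : DecidableEquality (ℕ × ℕ)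
  _≟ˡ_ = Product.≡-dec _≟_ _≟_

  _≟⁺_ : DecidableEquality (List⁺ ℕ)
  (x ∷ v) ≟⁺ (y ∷ w) = map′ (λ { (refl , refl) → refl }) (λ { refl → refl , refl })
      ((x ≟ y) ×-dec (v ≟ʷ w))

  cuts : Biword → Biword → List (Biword × Biword)
  cuts l []      = [ (l , []) ]
  cuts l (x ∷ z) = (l , x ∷ z) ∷ cuts (x ∷ l) z

  biletters : List⁺ ℕ → Biword
  biletters (x ∷ u) = (x , 1) ∷ zip u (map (2 +_) (upTo (length u)))

  numbers-biletters : ∀ f → numbers (biletters f) ≡ [1⋯ List⁺.length f ]
  numbers-biletters (x ∷ u) = cong (1 ∷_) (trans
    (numbers-zip u (map (2 +_) (upTo n)) (sym (trans (length-map _ (upTo n)) (length-applyUpTo id n))))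
    (trans (map-applyUpTo id (2 +_) n) (sym (map-applyUpTo suc suc n))))
    where n = length u

  colors-biletters : ∀ f → colors (biletters f) ≡ toList f
  colors-biletters (x ∷ u) = cong (x ∷_)
    (colors-zip u (map (2 +_) (upTo n)) (sym (trans (length-map _ (upTo n)) (length-applyUpTo id n))))
    where n = length u

  increasing-biletters : ∀ f → Increasing (biletters f)
  increasing-biletters f = Linked.map⁻ (subst (Linked _<_) (sym (numbers-biletters f))
    (subst (Linked _<_) (sym (map-upTo suc n)) (Linked.applyUpTo⁺₂ suc n (λ _ → ≤-refl))))
    where n = List⁺.length f

  merge≺-∈ˡ : ∀ {x} l r → x ∈ l → x ∈ merge≺ l r
  merge≺-∈ˡ l r x∈ = ↭.∈-resp-↭ (↭-sym (merge≺-↭ l r)) (∈-++⁺ˡ x∈)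

  merge≺-∈ʳ : ∀ {x} l r → x ∈ r → x ∈ merge≺ l r
  merge≺-∈ʳ l r x∈ = ↭.∈-resp-↭ (↭-sym (merge≺-↭ l r)) (∈-++⁺ʳ l x∈)

  _≟ᶠ_ : DecidableEquality (List (List⁺ ℕ))
  _≟ᶠ_ = ≡-dec _≟⁺_

  allPairs-++ : ∀ {a ℓ} {A : Set a} {R : A → A → Set ℓ} xs {ys} → AllPairs R (xs ++ ys) →
    ∀ {x y} → x ∈ xs → y ∈ ys → R x y
  allPairs-++ (x ∷ xs) (px ∷ _)  (here refl) y∈ = All.lookup px (∈-++⁺ʳ xs y∈)
  allPairs-++ (x ∷ xs) (_ ∷ pxs) (there x∈)  y∈ = allPairs-++ xs pxs x∈ y∈

  unique-++⁻ˡ : ∀ {a} {A : Set a} (xs {ys} : List A) → Unique (xs ++ ys) → Unique xs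
  unique-++⁻ˡ []       _          = []
  unique-++⁻ˡ (x ∷ xs) (x≢ ∷ xs!) = All.++⁻ˡ xs x≢ ∷ unique-++⁻ˡ xs xs!

  unique-++⁻ʳ : ∀ {a} {A : Set a} (xs {ys} : List A) → Unique (xs ++ ys) → Unique ys
  unique-++⁻ʳ []       ys!       = ys!
  unique-++⁻ʳ (x ∷ xs) (_ ∷ xs!) = unique-++⁻ʳ xs xs!

  zippers-sorted-↭ : ∀ z {l x r} → (l , x , r) ∈ zippers [] z → toList (sorted (l , x , r)) ↭ z
  zippers-sorted-↭ z {l} {x} {r} b∈ = ↭-trans (prep x (merge≺-↭ l r)) (zippers-↭ [] z b∈)

  module _ (z : Biword) (z! : Unique (numbers z)) {l x r} (b∈ : (l , x , r) ∈ zippers [] z) where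

    private
      b = (l , x , r)
      h = rank (numbers z)
      mono : Monotone h (numbers z)
      mono = rank-monotone (numbers z)

      letter-∈ : All (λ y → proj₂ y ∈ numbers z) (toList (sorted b))
      letter-∈ = All.tabulate λ y∈ → ∈-map⁺ proj₂ (↭.∈-resp-↭ (zippers-sorted-↭ z b∈) y∈)

      part-∈ : All (λ y → proj₂ y ∈ numbers z) (l ++ r)
      part-∈ = ↭.All-resp-↭ (merge≺-↭ l r) (All.tail letter-∈)

      sorted-relabel : toList (sorted (relabelᵇ h b)) ≡ relabel h (toList (sorted b))
      sorted-relabel = cong (map₂ h x ∷_)
          (relabel-merge mono l r (All.++⁻ˡ l part-∈) (All.++⁻ʳ l part-∈))

    -- The biletters increase, relabelling by ranks reflects order, and an increasing merge has
    -- increasing parts.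
    biletters⇒valley : ∀ f → toList (sorted (relabelᵇ h b)) ≡ biletters f → Valley b × f ≡ colorsᵇ b
    biletters⇒valley f eq =
      increasing-merge⁻ x l r (relabel-increasing⁻ mono letter-∈
        (subst Increasing (sym eq′) (increasing-biletters f))) ,
      toList-injective (trans (sym (colors-biletters f))
        (trans (cong colors (sym eq′)) (colors-relabel h (toList (sorted b)))))
      where
      eq′ = trans (sym sorted-relabel) eq
      toList-injective : ∀ {f g : List⁺ ℕ} → toList f ≡ toList g → f ≡ g
      toList-injective refl = refl

    -- The sorted block increases and its ranks lie in `1 ⋯ n`, where `n` is its length, so they can
    -- only be `1 ⋯ n` in order.
    valley⇒biletters : ∀ f → Valley b × f ≡ colorsᵇ b → toList (sorted (relabelᵇ h b)) ≡ biletters f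
    valley⇒biletters f ((incˡ , incʳ) , refl) = trans sorted-relabel (biword-ext
      (trans (colors-relabel h S) (sym (colors-biletters f)))
      (trans (increasing-unique 0 (numbers (relabel h S)) [1⋯ n ]
          (trans len (sym (trans (length-map suc (upTo n)) (length-applyUpTo id n))))
          (Linked.map⁺ (relabel-increasing⁺ mono letter-∈ inc))
          (subst (Linked _<_) (sym (map-upTo suc n)) (Linked.applyUpTo⁺₂ suc n (λ _ → ≤-refl)))
          (All.map proj₁ bounds)
          (All.map (λ p → ≤-trans (proj₂ p)
              (≤-reflexive (sym (length-map proj₂ (relabel h S))))) bounds)
          (All.tabulate λ y∈ → proj₁ (∈-[1⋯]⁻ y∈))
          (All.tabulate λ y∈ → ≤-trans (proj₂ (∈-[1⋯]⁻ y∈)) (≤-reflexive (sym len))))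
        (sym (numbers-biletters f))))
      where
      S = toList (sorted b)
      n = List⁺.length f

      inc : Increasing S
      inc = increasing-merge⁺ x l r (allPairs-++ l (AllPairs.map⁻ {f = proj₂} (AllPairs.tail
        (Unique-resp-↭ (↭.map⁺ proj₂ (↭-sym (zippers-↭ [] z b∈))) z!)))) incˡ incʳ

      len : length (numbers (relabel h S)) ≡ n
      len = trans (length-map proj₂ (relabel h S)) (trans (length-map (map₂ h) S)
        (cong suc (sym (length-map proj₁ (merge≺ l r)))))

      bounds : All (λ y → 1 ≤ y × y ≤ length (relabel h S)) (numbers (relabel h S))
      bounds = subst (λ k → All (λ y → 1 ≤ y × y ≤ k) (numbers (relabel h S)))
        (trans (length-map proj₂ z) (trans (sym (↭.↭-length (zippers-sorted-↭ z b∈)))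
            (sym (length-map (map₂ h) S))))
        (↭.All-resp-↭ (↭.map⁺ proj₂ (↭.map⁺ (map₂ h) (↭-sym (zippers-sorted-↭ z b∈))))
          (subst (All _) (sym (numbers-stdᵇ z))
              (IsPermutation.letters (∈-𝔖⁻ (length (numbers z)) (std-∈-𝔖 z!)))))

  -- Input of the automaton

  depth : List Block → ℕ
  depth []                 = 0
  depth ((l , _ , _) ∷ bs) = length l + depth bs

  -- For a biword z following a biletter with number t, under colors with maximum m: at each
  -- biletter, whether there is a descent of the numbers and whether the color is a record.
  steps : ℕ → ℕ → Biword → List (Bool × Bool)
  steps m t []            = []
  steps m t ((c , s) ∷ z) = (not (does (t <? s)) , does (m ≤? c)) ∷ steps (m ⊔ c) s z

  steps-descents : ∀ m t z → map proj₁ (steps m t z) ≡ descents t (numbers z)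
  steps-descents m t []            = refl
  steps-descents m t ((c , s) ∷ z) = cong (_ ∷_) (steps-descents (m ⊔ c) s z)

  steps-records : ∀ m t z → map proj₂ (steps m t z) ≡ records m (colors z)
  steps-records m t []            = refl
  steps-records m t ((c , s) ∷ z) = cong (_ ∷_) (steps-records (m ⊔ c) s z)

  -- `steps` records weak comparisons. Distinct letters make them strict, as the validity conditions
  -- require.
  Fresh : ℕ → ℕ → Biword → Set
  Fresh m t z = Unique (m ∷ colors z) × Unique (t ∷ numbers z)

  fresh-⊔ : ∀ {m t c s z} → Fresh m t ((c , s) ∷ z) → Fresh (m ⊔ c) s z
  fresh-⊔ {m} {c = c} ((_ ∷ m≢) ∷ c≢ ∷ cs! , _ ∷ ss!) with ⊔-sel m c
  ... | inj₁ eq rewrite eq = m≢ ∷ cs! , ss!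
  ... | inj₂ eq rewrite eq = c≢ ∷ cs! , ss!

  fresh-tail : ∀ {m t c s z} → Fresh m t ((c , s) ∷ z) → Fresh c s z
  fresh-tail (_ ∷ cs! , _ ∷ ss!) = cs! , ss!

  increasing-recolor : ∀ {a b t r} → Increasing ((a , t) ∷ r) → Increasing ((b , t) ∷ r)
  increasing-recolor [-]     = [-]
  increasing-recolor (p ∷ i) = p ∷ i

open Combinatorics

-- Finite sums and indicators in a commutative ring

module ListSums {c ℓ} (K : CommutativeRing c ℓ) where

  open CommutativeRing K
  open import Algebra.Properties.CommutativeSemigroup +-commutativeSemigroup using () renaming (interchange to +-interchange)
  open import Relation.Binary.Reasoning.Setoid setoid

  private variable
    a b p r : Level
    A : Set a
    B : Set b
    P : Set p
    Q : Set r

  ⟦_⟧ : Dec P → Carrier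
  ⟦ P? ⟧ = if does P? then 1# else 0#

  ⟦⟧-⇔ : (P? : Dec P) (Q? : Dec Q) → (P → Q) → (Q → P) → ⟦ P? ⟧ ≈ ⟦ Q? ⟧
  ⟦⟧-⇔ P? Q? f g = reflexive (≡.cong (if_then 1# else 0#) (does-⇔ (mk⇔ f g) P? Q?))

  ⟦⟧-yes : (P? : Dec P) → P → ⟦ P? ⟧ ≈ 1#
  ⟦⟧-yes P? x = reflexive (≡.cong (if_then 1# else 0#) (dec-true P? x))

  ⟦⟧-no : (P? : Dec P) → ¬ P → ⟦ P? ⟧ ≈ 0#
  ⟦⟧-no P? x = reflexive (≡.cong (if_then 1# else 0#) (dec-false P? x))

  ⟦⟧*-yes : (P? : Dec P) → P → ∀ {x} → ⟦ P? ⟧ * x ≈ x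
  ⟦⟧*-yes P? p = trans (*-congʳ (⟦⟧-yes P? p)) (*-identityˡ _)

  ⟦⟧*-no : (P? : Dec P) → ¬ P → ∀ {x} → ⟦ P? ⟧ * x ≈ 0#
  ⟦⟧*-no P? p = trans (*-congʳ (⟦⟧-no P? p)) (zeroˡ _)

  ⟦⟧-× : (P? : Dec P) (Q? : Dec Q) → ⟦ P? ×-dec Q? ⟧ ≈ ⟦ P? ⟧ * ⟦ Q? ⟧
  ⟦⟧-× (yes _) Q? = sym (*-identityˡ _)
  ⟦⟧-× (no _)  Q? = sym (zeroˡ _)

  ⟦⟧*-cong : (P? : Dec P) → ∀ {x y} → (P → x ≈ y) → ⟦ P? ⟧ * x ≈ ⟦ P? ⟧ * y
  ⟦⟧*-cong (yes p) f = *-congˡ (f p)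
  ⟦⟧*-cong (no _)  f = trans (zeroˡ _) (sym (zeroˡ _))

  infix 5 sumOver
  sumOver : List A → (A → Carrier) → Carrier
  sumOver []       f = 0#
  sumOver (x ∷ xs) f = f x + sumOver xs f

  syntax sumOver xs (λ x → e) = Σ[ x ∈ xs ] e

  Σ-cong-∈ : ∀ (xs : List A) {f g} → (∀ {x} → x ∈ xs → f x ≈ g x) →
    sumOver xs f ≈ sumOver xs g
  Σ-cong-∈ []       h = refl
  Σ-cong-∈ (x ∷ xs) h = +-cong (h (here ≡.refl)) (Σ-cong-∈ xs (h ∘ there))

  Σ-cong : ∀ (xs : List A) {f g} → (∀ x → f x ≈ g x) → sumOver xs f ≈ sumOver xs g
  Σ-cong xs h = Σ-cong-∈ xs (λ {x} _ → h x)

  Σ-0 : ∀ (xs : List A) → (Σ[ x ∈ xs ] 0#) ≈ 0#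
  Σ-0 []       = refl
  Σ-0 (x ∷ xs) = trans (+-identityˡ _) (Σ-0 xs)

  Σ-zero : ∀ (xs : List A) {f} → (∀ {x} → x ∈ xs → f x ≈ 0#) → sumOver xs f ≈ 0#
  Σ-zero xs h = trans (Σ-cong-∈ xs h) (Σ-0 xs)

  Σ-++ : ∀ (xs ys : List A) f → sumOver (xs ++ ys) f ≈ sumOver xs f + sumOver ys f
  Σ-++ []       ys f = sym (+-identityˡ _)
  Σ-++ (x ∷ xs) ys f = trans (+-congˡ (Σ-++ xs ys f)) (sym (+-assoc _ _ _))

  Σ-map : ∀ (h : A → B) xs f → sumOver (map h xs) f ≈ sumOver xs (f ∘ h)
  Σ-map h []       f = refl
  Σ-map h (x ∷ xs) f = +-congˡ (Σ-map h xs f)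

  Σ-concatMap : ∀ (h : A → List B) xs f →
    sumOver (concatMap h xs) f ≈ (Σ[ x ∈ xs ] Σ[ y ∈ h x ] f y)
  Σ-concatMap h []       f = refl
  Σ-concatMap h (x ∷ xs) f = trans (Σ-++ (h x) _ f) (+-congˡ (Σ-concatMap h xs f))

  Σ-filter : ∀ {P : A → Set p} (P? : Decidable₁ P) xs f →
    sumOver (filter P? xs) f ≈ (Σ[ x ∈ xs ] ⟦ P? x ⟧ * f x)
  Σ-filter P? []       f = refl
  Σ-filter P? (x ∷ xs) f with P? x
  ... | yes _ = +-cong (sym (*-identityˡ _)) (Σ-filter P? xs f)
  ... | no _  = trans (Σ-filter P? xs f) (sym (trans (+-congʳ (zeroˡ _)) (+-identityˡ _)))

  Σ-+ : ∀ (xs : List A) f g → (Σ[ x ∈ xs ] f x + g x) ≈ sumOver xs f + sumOver xs g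
  Σ-+ []       f g = sym (+-identityˡ _)
  Σ-+ (x ∷ xs) f g = trans (+-congˡ (Σ-+ xs f g)) (+-interchange _ _ _ _)

  *-Σ : ∀ (xs : List A) k f → k * sumOver xs f ≈ (Σ[ x ∈ xs ] k * f x)
  *-Σ []       k f = zeroʳ k
  *-Σ (x ∷ xs) k f = trans (distribˡ k _ _) (+-congˡ (*-Σ xs k f))

  Σ-* : ∀ (xs : List A) k f → sumOver xs f * k ≈ (Σ[ x ∈ xs ] f x * k)
  Σ-* []       k f = zeroˡ k
  Σ-* (x ∷ xs) k f = trans (distribʳ k _ _) (+-congˡ (Σ-* xs k f))

  Σ-comm : ∀ (xs : List A) (ys : List B) (f : A → B → Carrier) →
    (Σ[ x ∈ xs ] Σ[ y ∈ ys ] f x y) ≈ (Σ[ y ∈ ys ] Σ[ x ∈ xs ] f x y)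
  Σ-comm []       ys f = sym (Σ-0 ys)
  Σ-comm (x ∷ xs) ys f = trans (+-congˡ (Σ-comm xs ys f)) (sym (Σ-+ ys (f x) _))

  module _ (_≟_ : DecidableEquality A) where

    Σ-∉ : ∀ xs {x} (f : A → Carrier) → x ∉ xs → (Σ[ y ∈ xs ] ⟦ y ≟ x ⟧ * f y) ≈ 0#
    Σ-∉ xs {x} f x∉xs = Σ-zero xs λ {y} y∈xs →
      ⟦⟧*-no (y ≟ x) λ y≡x → x∉xs (≡.subst (_∈ xs) y≡x y∈xs)

    Σ-∈ : ∀ {xs x} (f : A → Carrier) → Unique xs → x ∈ xs → (Σ[ y ∈ xs ] ⟦ y ≟ x ⟧ * f y) ≈ f x
    Σ-∈ {xs = x ∷ xs} f (x≢ ∷ _) (here ≡.refl) = trans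
      (+-cong (⟦⟧*-yes (x ≟ x) ≡.refl)
              (Σ-∉ xs f λ x∈xs → All.lookup x≢ x∈xs ≡.refl))
      (+-identityʳ _)
    Σ-∈ {xs = y ∷ xs} {x} f (y≢ ∷ u) (there x∈xs) = trans
      (+-cong (⟦⟧*-no (y ≟ x) (All.lookup y≢ x∈xs)) (Σ-∈ f u x∈xs))
      (+-identityˡ _)

module Expansion {c ℓ} (K : CommutativeRing c ℓ) (q : CommutativeRing.Carrier K) where

  open CommutativeRing K
  open BiwordAlgebra K q
  open ListSums K
  open import Algebra.Properties.Semiring.Exp semiring using (_^_; ^-homo-*)
  open import Algebra.Properties.CommutativeSemigroup *-commutativeSemigroup using (x∙yz≈y∙xz; interchange)
  open import Relation.Binary.Reasoning.Setoid setoid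

  -- Coefficients of formal linear combinations

  coefficient-++ : ∀ f g w → coefficient (f ++ g) w ≈ coefficient f w + coefficient g w
  coefficient-++ []            g w = sym (+-identityˡ _)
  coefficient-++ ((a , v) ∷ f) g w with does (v ≟ᵇ w)
  ... | true  = trans (+-congˡ (coefficient-++ f g w)) (sym (+-assoc _ _ _))
  ... | false = coefficient-++ f g w

  coefficient-∑ : ∀ {a} {A : Set a} (xs : List A) f w →
    coefficient (∑ xs f) w ≈ (Σ[ x ∈ xs ] coefficient (f x) w)
  coefficient-∑ []       f w = refl
  coefficient-∑ (x ∷ xs) f w = trans (coefficient-++ (f x) _ w) (+-congˡ (coefficient-∑ xs f w))

  coefficient-• : ∀ k f w → coefficient (k • f) w ≈ k * coefficient f w
  coefficient-• k []            w = sym (zeroʳ k)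
  coefficient-• k ((a , v) ∷ f) w with does (v ≟ᵇ w)
  ... | true  = trans (+-congˡ (coefficient-• k f w)) (sym (distribˡ k _ _))
  ... | false = coefficient-• k f w

  coefficient-⟨⟩ : ∀ v w → coefficient ⟨ v ⟩ w ≈ ⟦ v ≟ᵇ w ⟧
  coefficient-⟨⟩ v w with does (v ≟ᵇ w)
  ... | true  = +-identityʳ _
  ... | false = refl

  coefficient-Σ : ∀ f w → coefficient f w ≈ (Σ[ (a , v) ∈ f ] a * ⟦ v ≟ᵇ w ⟧)
  coefficient-Σ []            w = refl
  coefficient-Σ ((a , v) ∷ f) w with does (v ≟ᵇ w)
  ... | true  = +-cong (sym (*-identityʳ a)) (coefficient-Σ f w)
  ... | false = trans (coefficient-Σ f w) (sym (trans (+-congʳ (zeroʳ a)) (+-identityˡ _)))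

  coefficient-bilinear : ∀ m f g w → coefficient (bilinear m f g) w ≈
    (Σ[ (a , v) ∈ f ] Σ[ (b , u) ∈ g ] (a * b) * coefficient (m v u) w)
  coefficient-bilinear m f g w = trans (coefficient-∑ f _ w) (Σ-cong f λ (a , v) →
    trans (coefficient-∑ g _ w) (Σ-cong g λ (b , u) → coefficient-• (a * b) (m v u) w))

  -- The product of colored free quasi-symmetric functions

  Σ-splits-length : ∀ z k (g : Biword → Biword → Carrier) → k ≤ length z →
    (Σ[ (u , v) ∈ splits z ] ⟦ length u ≟ k ⟧ * g u v) ≈ g (take k z) (drop k z)
  Σ-splits-length []      zero    g _ = trans (+-identityʳ _) (*-identityˡ _)
  Σ-splits-length (x ∷ z) zero    g _ = trans
    (+-cong (*-identityˡ _) (trans (Σ-map (map₁ (x ∷_)) (splits z) _)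
        (Σ-zero (splits z) λ _ → zeroˡ _)))
    (+-identityʳ _)
  Σ-splits-length (x ∷ z) (suc k) g (s≤s k≤) = trans
    (+-cong (zeroˡ _) (trans (Σ-map (map₁ (x ∷_)) (splits z) _) (Σ-splits-length z k (g ∘ (x ∷_)) k≤)))
    (+-identityˡ _)

  ⋆-basis : Biword → Biword → Formal
  ⋆-basis v u = ∑[ γ ∈ numbers v ∗ numbers u ] ⟨ zip (colors v ++ colors u) γ ⟩

  module _ (v u w : Biword) where

    private
      a = length (numbers v)
      m = a ℕ.+ length (numbers u)
      std? = λ γ → (std (take a γ) ≟ʷ numbers v) ×-dec (std (drop a γ) ≟ʷ numbers u)

      basisTerm : Word → Carrier
      basisTerm γ = ⟦ std? γ ⟧ * ⟦ (colors v ++ colors u) ≟ʷ colors w ⟧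

      length-colors : length (colors v ++ colors u) ≡ m
      length-colors = ≡.trans (length-++ (colors v)) (≡.cong₂ ℕ._+_
        (≡.trans (length-map proj₁ v) (≡.sym (length-map proj₂ v)))
        (≡.trans (length-map proj₁ u) (≡.sym (length-map proj₂ u))))

      zip-≡⁻ : ∀ {γ} → γ ∈ 𝔖 m → zip (colors v ++ colors u) γ ≡ w →
        γ ≡ numbers w × colors v ++ colors u ≡ colors w
      zip-≡⁻ {γ} γ∈ eq =
        ≡.trans (≡.sym (numbers-zip _ γ len)) (≡.cong numbers eq) ,
        ≡.trans (≡.sym (colors-zip _ γ len)) (≡.cong colors eq)
        where len = ≡.trans length-colors (≡.sym (𝔖-length m γ∈))

    coefficient-⋆-basis : coefficient (⋆-basis v u) w ≈
      (Σ[ γ ∈ 𝔖 m ] ⟦ γ ≟ʷ numbers w ⟧ * basisTerm γ)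
    coefficient-⋆-basis = begin
      coefficient (⋆-basis v u) w
        ≈⟨ coefficient-∑ (numbers v ∗ numbers u) _ w ⟩
      (Σ[ γ ∈ numbers v ∗ numbers u ] coefficient ⟨ zip (colors v ++ colors u) γ ⟩ w)
        ≈⟨ Σ-cong (numbers v ∗ numbers u) (λ γ → coefficient-⟨⟩ (zip (colors v ++ colors u) γ) w) ⟩
      (Σ[ γ ∈ numbers v ∗ numbers u ] ⟦ zip (colors v ++ colors u) γ ≟ᵇ w ⟧)
        ≈⟨ Σ-filter std? (𝔖 m) _ ⟩
      (Σ[ γ ∈ 𝔖 m ] ⟦ std? γ ⟧ * ⟦ zip (colors v ++ colors u) γ ≟ᵇ w ⟧)
        ≈⟨ Σ-cong-∈ (𝔖 m) (λ {γ} γ∈ → trans (*-congˡ (trans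
             (⟦⟧-⇔ (zip (colors v ++ colors u) γ ≟ᵇ w)
                 ((γ ≟ʷ numbers w) ×-dec ((colors v ++ colors u) ≟ʷ colors w))
               (zip-≡⁻ γ∈)
               (λ { (≡.refl , eq) → ≡.trans (≡.cong (λ c → zip c (numbers w)) eq)
                   (zip-colors-numbers w) }))
             (⟦⟧-× (γ ≟ʷ numbers w) ((colors v ++ colors u) ≟ʷ colors w)))) (x∙yz≈y∙xz _ _ _)) ⟩
      (Σ[ γ ∈ 𝔖 m ] ⟦ γ ≟ʷ numbers w ⟧ * basisTerm γ) ∎

    coefficient-⋆-basis-∉ : numbers w ∉ 𝔖 (length w) → coefficient (⋆-basis v u) w ≈ 0#
    coefficient-⋆-basis-∉ w∉ = trans coefficient-⋆-basis (Σ-∉ _≟ʷ_ (𝔖 m) basisTerm λ w∈ →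
      w∉ (≡.subst (λ n → numbers w ∈ 𝔖 n) (≡.trans (≡.sym (𝔖-length m w∈)) (length-map proj₂ w)) w∈))

    stdᵇ-parts : (v ≡ stdᵇ (take a w) × u ≡ stdᵇ (drop a w)) →
      (std (take a (numbers w)) ≡ numbers v × std (drop a (numbers w)) ≡ numbers u)
          × colors v ++ colors u ≡ colors w
    stdᵇ-parts (v≡ , u≡) =
      ( ≡.trans (≡.cong std (take-map a w))
          (≡.trans (≡.sym (numbers-stdᵇ (take a w))) (≡.cong numbers (≡.sym v≡)))
      , ≡.trans (≡.cong std (drop-map a w))
          (≡.trans (≡.sym (numbers-stdᵇ (drop a w))) (≡.cong numbers (≡.sym u≡)))) ,
      ≡.trans (≡.cong₂ _++_
          (≡.trans (≡.cong colors v≡) (colors-stdᵇ (take a w)))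
          (≡.trans (≡.cong colors u≡) (colors-stdᵇ (drop a w))))
        (≡.trans (≡.sym (map-++ proj₁ (take a w) (drop a w))) (≡.cong colors (take++drop≡id a w)))

    parts-stdᵇ : (std (take a (numbers w)) ≡ numbers v × std (drop a (numbers w)) ≡ numbers u)
        × colors v ++ colors u ≡ colors w →
      v ≡ stdᵇ (take a w) × u ≡ stdᵇ (drop a w)
    parts-stdᵇ ((p , r) , eq) =
      biword-ext (≡.trans cv (≡.sym (colors-stdᵇ (take a w))))
        (≡.trans (≡.sym p) (≡.trans (≡.cong std (take-map a w)) (≡.sym (numbers-stdᵇ (take a w))))) ,
      biword-ext (≡.trans cu (≡.sym (colors-stdᵇ (drop a w))))
        (≡.trans (≡.sym r) (≡.trans (≡.cong std (drop-map a w)) (≡.sym (numbers-stdᵇ (drop a w)))))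
      where
      a≡ : a ≡ length (colors v)
      a≡ = ≡.trans (length-map proj₂ v) (≡.sym (length-map proj₁ v))
      cv : colors v ≡ colors (take a w)
      cv = ≡.trans (≡.sym (≡.trans (≡.cong (λ k → take k (colors v ++ colors u)) a≡)
          (take-++ (colors v) (colors u))))
             (≡.trans (≡.cong (take a) eq) (take-map a w))
      cu : colors u ≡ colors (drop a w)
      cu = ≡.trans (≡.sym (≡.trans (≡.cong (λ k → drop k (colors v ++ colors u)) a≡)
          (drop-++ (colors v) (colors u))))
             (≡.trans (≡.cong (drop a) eq) (drop-map a w))

    length-stdᵇ : ∀ {x y} → (x , y) ∈ splits w → v ≡ stdᵇ x → u ≡ stdᵇ y → length w ≡ m
    length-stdᵇ {x} {y} xy∈ ≡.refl ≡.refl = ≡.trans (≡.cong length (≡.sym (++-splits w xy∈)))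
      (≡.trans (length-++ x) (≡.cong₂ ℕ._+_
        (≡.sym (≡.trans (length-map proj₂ (stdᵇ x)) (stdᵇ-length x)))
        (≡.sym (≡.trans (length-map proj₂ (stdᵇ y)) (stdᵇ-length y)))))

    -- Only the split after `a` letters can contribute, since `v ≡ stdᵇ x` fixes the length of `x`.
    -- Summing over all splits makes the range independent of `v` and `u`, so that for general `f`
    -- and `g` the sums can be exchanged and factored.
    coefficient-⋆-basis-∈ : numbers w ∈ 𝔖 (length w) → coefficient (⋆-basis v u) w ≈
      (Σ[ (x , y) ∈ splits w ] ⟦ v ≟ᵇ stdᵇ x ⟧ * ⟦ u ≟ᵇ stdᵇ y ⟧)
    coefficient-⋆-basis-∈ w∈ with length w ≟ m
    ... | no len≢ = begin
      coefficient (⋆-basis v u) w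
        ≈⟨ coefficient-⋆-basis ⟩
      _ ≈⟨ Σ-∉ _≟ʷ_ (𝔖 m) basisTerm (λ w∈′ →
          len≢ (≡.trans (≡.sym (length-map proj₂ w)) (𝔖-length m w∈′))) ⟩
      0#
        ≈⟨ Σ-zero (splits w) (λ {(x , y)} xy∈ → trans (sym (⟦⟧-× (v ≟ᵇ stdᵇ x) (u ≟ᵇ stdᵇ y)))
             (⟦⟧-no ((v ≟ᵇ stdᵇ x) ×-dec (u ≟ᵇ stdᵇ y)) λ (v≡ , u≡) → len≢ (length-stdᵇ xy∈ v≡ u≡))) ⟨
      (Σ[ (x , y) ∈ splits w ] ⟦ v ≟ᵇ stdᵇ x ⟧ * ⟦ u ≟ᵇ stdᵇ y ⟧) ∎
    ... | yes len≡ = begin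
      coefficient (⋆-basis v u) w
        ≈⟨ coefficient-⋆-basis ⟩
      _ ≈⟨ Σ-∈ _≟ʷ_ basisTerm (𝔖-unique m) (≡.subst (λ n → numbers w ∈ 𝔖 n) len≡ w∈) ⟩
      ⟦ std? (numbers w) ⟧ * ⟦ (colors v ++ colors u) ≟ʷ colors w ⟧
        ≈⟨ ⟦⟧-× (std? (numbers w)) ((colors v ++ colors u) ≟ʷ colors w) ⟨
      ⟦ std? (numbers w) ×-dec ((colors v ++ colors u) ≟ʷ colors w) ⟧
        ≈⟨ ⟦⟧-⇔ (std? (numbers w) ×-dec ((colors v ++ colors u) ≟ʷ colors w))
            ((v ≟ᵇ stdᵇ (take a w)) ×-dec (u ≟ᵇ stdᵇ (drop a w))) parts-stdᵇ stdᵇ-parts ⟩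
      ⟦ (v ≟ᵇ stdᵇ (take a w)) ×-dec (u ≟ᵇ stdᵇ (drop a w)) ⟧
        ≈⟨ ⟦⟧-× (v ≟ᵇ stdᵇ (take a w)) (u ≟ᵇ stdᵇ (drop a w)) ⟩
      ⟦ v ≟ᵇ stdᵇ (take a w) ⟧ * ⟦ u ≟ᵇ stdᵇ (drop a w) ⟧
        ≈⟨ Σ-splits-length w a (λ x y → ⟦ v ≟ᵇ stdᵇ x ⟧ * ⟦ u ≟ᵇ stdᵇ y ⟧)
             (≤-trans (m≤m+n a _) (≤-reflexive (≡.sym len≡))) ⟨
      (Σ[ (x , y) ∈ splits w ] ⟦ length x ≟ a ⟧ * (⟦ v ≟ᵇ stdᵇ x ⟧ * ⟦ u ≟ᵇ stdᵇ y ⟧))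
        ≈⟨ Σ-cong (splits w) (λ (x , y) → begin
             ⟦ length x ≟ a ⟧ * (⟦ v ≟ᵇ stdᵇ x ⟧ * ⟦ u ≟ᵇ stdᵇ y ⟧) ≈⟨ x∙yz≈y∙xz _ _ _ ⟩
             ⟦ v ≟ᵇ stdᵇ x ⟧ * (⟦ length x ≟ a ⟧ * ⟦ u ≟ᵇ stdᵇ y ⟧)
               ≈⟨ ⟦⟧*-cong (v ≟ᵇ stdᵇ x) (λ v≡ → ⟦⟧*-yes (length x ≟ a)
                    (≡.sym (≡.trans (length-map proj₂ v)
                        (≡.trans (≡.cong length v≡) (stdᵇ-length x))))) ⟩
             ⟦ v ≟ᵇ stdᵇ x ⟧ * ⟦ u ≟ᵇ stdᵇ y ⟧ ∎) ⟩
      (Σ[ (x , y) ∈ splits w ] ⟦ v ≟ᵇ stdᵇ x ⟧ * ⟦ u ≟ᵇ stdᵇ y ⟧) ∎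

  coefficient-⋆-∉ : ∀ f g w → numbers w ∉ 𝔖 (length w) → coefficient (f ⋆ g) w ≈ 0#
  coefficient-⋆-∉ f g w w∉ = trans (coefficient-bilinear ⋆-basis f g w)
    (Σ-zero f λ {(a , v)} _ → Σ-zero g λ {(b , u)} _ →
      trans (*-congˡ (coefficient-⋆-basis-∉ v u w w∉)) (zeroʳ _))

  coefficient-⋆-∈ : ∀ f g w → numbers w ∈ 𝔖 (length w) → coefficient (f ⋆ g) w ≈
    (Σ[ (x , y) ∈ splits w ] coefficient f (stdᵇ x) * coefficient g (stdᵇ y))
  coefficient-⋆-∈ f g w w∈ = begin
    coefficient (f ⋆ g) w
      ≈⟨ coefficient-bilinear ⋆-basis f g w ⟩
    (Σ[ (a , v) ∈ f ] Σ[ (b , u) ∈ g ] (a * b) * coefficient (⋆-basis v u) w)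
      ≈⟨ Σ-cong f (λ (a , v) → Σ-cong g λ (b , u) → trans
           (*-congˡ (coefficient-⋆-basis-∈ v u w w∈))
               (*-Σ (splits w) (a * b) (λ (x , y) → ⟦ v ≟ᵇ stdᵇ x ⟧ * ⟦ u ≟ᵇ stdᵇ y ⟧))) ⟩
    (Σ[ (a , v) ∈ f ] Σ[ (b , u) ∈ g ] Σ[ (x , y) ∈ splits w ]
      (a * b) * (⟦ v ≟ᵇ stdᵇ x ⟧ * ⟦ u ≟ᵇ stdᵇ y ⟧))
      ≈⟨ Σ-cong f (λ (a , v) → Σ-comm g (splits w)
          (λ (b , u) (x , y) → (a * b) * (⟦ v ≟ᵇ stdᵇ x ⟧ * ⟦ u ≟ᵇ stdᵇ y ⟧))) ⟩
    (Σ[ (a , v) ∈ f ] Σ[ (x , y) ∈ splits w ] Σ[ (b , u) ∈ g ]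
      (a * b) * (⟦ v ≟ᵇ stdᵇ x ⟧ * ⟦ u ≟ᵇ stdᵇ y ⟧))
      ≈⟨ Σ-comm f (splits w) (λ (a , v) (x , y) →
          Σ[ (b , u) ∈ g ] (a * b) * (⟦ v ≟ᵇ stdᵇ x ⟧ * ⟦ u ≟ᵇ stdᵇ y ⟧)) ⟩
    (Σ[ (x , y) ∈ splits w ] Σ[ (a , v) ∈ f ] Σ[ (b , u) ∈ g ]
      (a * b) * (⟦ v ≟ᵇ stdᵇ x ⟧ * ⟦ u ≟ᵇ stdᵇ y ⟧))
      ≈⟨ Σ-cong (splits w) (λ (x , y) → begin
           (Σ[ (a , v) ∈ f ] Σ[ (b , u) ∈ g ] (a * b) * (⟦ v ≟ᵇ stdᵇ x ⟧ * ⟦ u ≟ᵇ stdᵇ y ⟧))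
             ≈⟨ Σ-cong f (λ (a , v) → trans (Σ-cong g λ (b , u) → interchange _ _ _ _)
                 (sym (*-Σ g (a * ⟦ v ≟ᵇ stdᵇ x ⟧) (λ (b , u) → b * ⟦ u ≟ᵇ stdᵇ y ⟧)))) ⟩
           (Σ[ (a , v) ∈ f ] (a * ⟦ v ≟ᵇ stdᵇ x ⟧) * (Σ[ (b , u) ∈ g ] b * ⟦ u ≟ᵇ stdᵇ y ⟧))
             ≈⟨ Σ-* f (Σ[ (b , u) ∈ g ] b * ⟦ u ≟ᵇ stdᵇ y ⟧) (λ (a , v) → a * ⟦ v ≟ᵇ stdᵇ x ⟧) ⟨
           (Σ[ (a , v) ∈ f ] a * ⟦ v ≟ᵇ stdᵇ x ⟧) * (Σ[ (b , u) ∈ g ] b * ⟦ u ≟ᵇ stdᵇ y ⟧)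
             ≈⟨ *-cong (coefficient-Σ f (stdᵇ x)) (coefficient-Σ g (stdᵇ y)) ⟨
           coefficient f (stdᵇ x) * coefficient g (stdᵇ y) ∎) ⟩
    (Σ[ (x , y) ∈ splits w ] coefficient f (stdᵇ x) * coefficient g (stdᵇ y)) ∎

  -- The elements Ψ

  bracketWith : Formal → ℕ × ℕ → Formal
  bracketWith f b = [ f , ⟨ [ b ] ⟩ ]q

  -- The coefficient of z in the iterated bracket of v with the biletters bs.
  grow : Biword → Biword → Biword → Carrier
  grow v []       z = ⟦ v ≟ᵇ z ⟧
  grow v (b ∷ bs) z = grow (v ++ [ b ]) bs z + (- q) * grow (b ∷ v) bs z

  Σ-·⟨⟩ : ∀ f b (g : Biword → Carrier) →
    (Σ[ (a , v) ∈ f · ⟨ [ b ] ⟩ ] a * g v) ≈ (Σ[ (a , v) ∈ f ] a * g (v ++ [ b ]))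
  Σ-·⟨⟩ f b g = trans (Σ-concatMap _ f _) (Σ-cong f λ (a , v) →
    trans (+-identityʳ _) (*-congʳ (trans (*-identityʳ _) (*-identityʳ a))))

  Σ-⟨⟩· : ∀ f b (g : Biword → Carrier) →
    (Σ[ (a , v) ∈ ⟨ [ b ] ⟩ · f ] a * g v) ≈ (Σ[ (a , v) ∈ f ] a * g (b ∷ v))
  Σ-⟨⟩· f b g = begin
    (Σ[ (a , v) ∈ terms ++ [] ] a * g v)
      ≈⟨ Σ-++ terms [] _ ⟩
    (Σ[ (a , v) ∈ terms ] a * g v) + 0#
      ≈⟨ trans (+-identityʳ _) (Σ-concatMap (λ (a , v) → (1# * a) • ⟨ b ∷ v ⟩) f _) ⟩
    _ ≈⟨ Σ-cong f (λ (a , v) → trans (+-identityʳ _)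
        (*-congʳ (trans (*-identityʳ _) (*-identityˡ a)))) ⟩
    (Σ[ (a , v) ∈ f ] a * g (b ∷ v)) ∎
    where terms = ∑[ (a , v) ∈ f ] ((1# * a) • ⟨ b ∷ v ⟩)

  coefficient-brackets : ∀ f bs z →
    coefficient (foldl bracketWith f bs) z ≈ (Σ[ (a , v) ∈ f ] a * grow v bs z)
  coefficient-brackets f []       z = coefficient-Σ f z
  coefficient-brackets f (b ∷ bs) z = begin
    coefficient (foldl bracketWith (bracketWith f b) bs) z
      ≈⟨ coefficient-brackets (bracketWith f b) bs z ⟩
    (Σ[ (a , v) ∈ bracketWith f b ] a * grow v bs z)
      ≈⟨ Σ-++ (f · ⟨ [ b ] ⟩) _ _ ⟩
    (Σ[ (a , v) ∈ f · ⟨ [ b ] ⟩ ] a * grow v bs z)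
        + (Σ[ (a , v) ∈ (- q) • (⟨ [ b ] ⟩ · f) ] a * grow v bs z)
      ≈⟨ +-cong (Σ-·⟨⟩ f b (λ v → grow v bs z)) (begin
           (Σ[ (a , v) ∈ (- q) • (⟨ [ b ] ⟩ · f) ] a * grow v bs z)
             ≈⟨ Σ-map _ (⟨ [ b ] ⟩ · f) _ ⟩
           (Σ[ (a , v) ∈ ⟨ [ b ] ⟩ · f ] ((- q) * a) * grow v bs z)
             ≈⟨ Σ-cong (⟨ [ b ] ⟩ · f) (λ _ → trans (*-congʳ (*-comm _ _)) (*-assoc _ _ _)) ⟩
           (Σ[ (a , v) ∈ ⟨ [ b ] ⟩ · f ] a * ((- q) * grow v bs z))
             ≈⟨ Σ-⟨⟩· f b (λ v → (- q) * grow v bs z) ⟩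
           (Σ[ (a , v) ∈ f ] a * ((- q) * grow (b ∷ v) bs z)) ∎) ⟩
    (Σ[ (a , v) ∈ f ] a * grow (v ++ [ b ]) bs z) + (Σ[ (a , v) ∈ f ] a * ((- q) * grow (b ∷ v) bs z))
      ≈⟨ Σ-+ f _ _ ⟨
    (Σ[ (a , v) ∈ f ] a * grow (v ++ [ b ]) bs z + a * ((- q) * grow (b ∷ v) bs z))
      ≈⟨ Σ-cong f (λ (a , v) → sym (distribˡ a _ _)) ⟩
    (Σ[ (a , v) ∈ f ] a * grow v (b ∷ bs) z) ∎

  -- Matching in continuation style: a failed match contributes `0#`, and the result is linear in
  -- the continuation `g`.
  behead : ℕ × ℕ → Biword → (Biword → Carrier) → Carrier
  behead b []      g = 0#
  behead b (x ∷ z) g = ⟦ x ≟ˡ b ⟧ * g z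

  strip : Biword → Biword → (Biword → Carrier) → Carrier
  strip []      z g = g z
  strip (b ∷ v) z g = behead b z λ z′ → strip v z′ g

  -- How a word grows by bs to the right into r and, with factor - q, to the left into l, where
  -- l is read from right to left.
  shuffles : Biword → Biword → Biword → Carrier
  shuffles l r []       = ⟦ l ≟ᵇ [] ⟧ * ⟦ r ≟ᵇ [] ⟧
  shuffles l r (b ∷ bs) =
    behead b r (λ r′ → shuffles l r′ bs) + (- q) * behead b l (λ l′ → shuffles l′ r bs)

  behead-cong : ∀ b z {g g′} → (∀ z′ → g z′ ≈ g′ z′) → behead b z g ≈ behead b z g′
  behead-cong b []      h = refl
  behead-cong b (x ∷ z) h = *-congˡ (h z)

  behead-0 : ∀ b z → behead b z (λ _ → 0#) ≈ 0#
  behead-0 b []      = refl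
  behead-0 b (x ∷ z) = zeroʳ _

  behead-+ : ∀ b z g g′ → behead b z (λ z′ → g z′ + g′ z′) ≈ behead b z g + behead b z g′
  behead-+ b []      g g′ = sym (+-identityˡ _)
  behead-+ b (x ∷ z) g g′ = distribˡ _ _ _

  behead-* : ∀ b z k g → behead b z (λ z′ → k * g z′) ≈ k * behead b z g
  behead-* b []      k g = sym (zeroʳ k)
  behead-* b (x ∷ z) k g = x∙yz≈y∙xz _ _ _

  strip-cong : ∀ v z {g g′} → (∀ z′ → g z′ ≈ g′ z′) → strip v z g ≈ strip v z g′
  strip-cong []      z h = h z
  strip-cong (b ∷ v) z h = behead-cong b z λ z′ → strip-cong v z′ h

  strip-0 : ∀ v z → strip v z (λ _ → 0#) ≈ 0#
  strip-0 []      z = refl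
  strip-0 (b ∷ v) z = trans (behead-cong b z (strip-0 v)) (behead-0 b z)

  strip-+ : ∀ v z g g′ → strip v z (λ z′ → g z′ + g′ z′) ≈ strip v z g + strip v z g′
  strip-+ []      z g g′ = refl
  strip-+ (b ∷ v) z g g′ = trans (behead-cong b z λ z′ → strip-+ v z′ g g′) (behead-+ b z _ _)

  strip-* : ∀ v z k g → strip v z (λ z′ → k * g z′) ≈ k * strip v z g
  strip-* []      z k g = refl
  strip-* (b ∷ v) z k g = trans (behead-cong b z λ z′ → strip-* v z′ k g) (behead-* b z k _)

  strip-∷ʳ : ∀ v b z g → strip (v ++ [ b ]) z g ≈ strip v z (λ z′ → behead b z′ g)
  strip-∷ʳ []      b z g = refl
  strip-∷ʳ (x ∷ v) b z g = behead-cong x z λ z′ → strip-∷ʳ v b z′ g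

  strip-behead : ∀ v z b l (g : Biword → Biword → Carrier) →
    strip v z (λ r → behead b l (λ l′ → g l′ r)) ≈ behead b l (λ l′ → strip v z (g l′))
  strip-behead v z b []      g = strip-0 v z
  strip-behead v z b (x ∷ l) g = strip-* v z _ (g l)

  strip-all : ∀ v z → strip v z (λ r → ⟦ r ≟ᵇ [] ⟧) ≈ ⟦ v ≟ᵇ z ⟧
  strip-all []      z       = ⟦⟧-⇔ (z ≟ᵇ []) ([] ≟ᵇ z) ≡.sym ≡.sym
  strip-all (b ∷ v) []      = refl
  strip-all (b ∷ v) (x ∷ z) = trans (*-congˡ (strip-all v z)) (trans (sym (⟦⟧-× (x ≟ˡ b) (v ≟ᵇ z)))
    (⟦⟧-⇔ ((x ≟ˡ b) ×-dec (v ≟ᵇ z)) ((b ∷ v) ≟ᵇ (x ∷ z))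
      (λ { (≡.refl , ≡.refl) → ≡.refl }) (λ { ≡.refl → ≡.refl , ≡.refl })))

  cuts-strip-0 : ∀ x l z v →
    (Σ[ (l′ , s) ∈ cuts (x ∷ l) z ] strip v s (λ r → ⟦ l′ ≟ᵇ [] ⟧ * ⟦ r ≟ᵇ [] ⟧)) ≈ 0#
  cuts-strip-0 x l []      v = trans (+-identityʳ _)
      (trans (strip-cong v [] λ _ → zeroˡ _) (strip-0 v []))
  cuts-strip-0 x l (y ∷ z) v = trans
      (+-cong (trans (strip-cong v (y ∷ z) λ _ → zeroˡ _) (strip-0 v (y ∷ z)))
    (cuts-strip-0 y (x ∷ l) z v)) (+-identityʳ _)

  -- Moving `b` across a cut leads to the next cut. Only the first cut on the right has no
  -- predecessor; it is the extra term on the left.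
  cuts-shift : ∀ b l z (g : Biword → Biword → Carrier) →
    (Σ[ (l′ , s) ∈ cuts l z ] behead b s (g l′)) + behead b l (λ l′ → g l′ z)
    ≈ (Σ[ (l′ , s) ∈ cuts l z ] behead b l′ (λ l″ → g l″ s))
  cuts-shift b l []      g = trans (+-congʳ (+-identityʳ _)) (+-comm _ _)
  cuts-shift b l (x ∷ z) g = trans (+-comm _ _)
      (+-congˡ (trans (+-comm _ _) (cuts-shift b (x ∷ l) z g)))

  -- The initial word `v` remains a factor of every word produced, so one sums over the place where
  -- it starts. Adjoining `b` on the right lengthens the factor to be stripped; adjoining it on the
  -- left moves the cut by `cuts-shift`.
  grow-cuts : ∀ v bs z → grow v bs z ≈ (Σ[ (l , s) ∈ cuts [] z ] strip v s (λ r → shuffles l r bs))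
  grow-cuts v [] z = sym (base z)
    where
    base : ∀ z → (Σ[ (l , s) ∈ cuts [] z ] strip v s (λ r → ⟦ l ≟ᵇ [] ⟧ * ⟦ r ≟ᵇ [] ⟧)) ≈ ⟦ v ≟ᵇ z ⟧
    base []      = trans (+-identityʳ _) (trans (strip-cong v [] λ _ → *-identityˡ _) (strip-all v []))
    base (x ∷ z) = trans (+-cong (trans (strip-cong v (x ∷ z) λ _ → *-identityˡ _)
        (strip-all v (x ∷ z)))
      (cuts-strip-0 x [] z v)) (+-identityʳ _)
  grow-cuts v (b ∷ bs) z = begin
    grow (v ++ [ b ]) bs z + (- q) * grow (b ∷ v) bs z
      ≈⟨ +-cong (trans (grow-cuts (v ++ [ b ]) bs z) (Σ-cong C λ (l , s) → strip-∷ʳ v b s _))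
                (*-congˡ (trans (grow-cuts (b ∷ v) bs z) (trans (sym (+-identityʳ _))
                  (trans (cuts-shift b [] z (λ l s → strip v s (λ r → shuffles l r bs)))
                    (Σ-cong C λ (l , s) → sym (strip-behead v s b l (λ l′ r → shuffles l′ r bs))))))) ⟩
    (Σ[ (l , s) ∈ C ] strip v s (λ r → behead b r (λ r′ → shuffles l r′ bs)))
      + (- q) * (Σ[ (l , s) ∈ C ] strip v s (λ r → behead b l (λ l′ → shuffles l′ r bs)))
      ≈⟨ +-congˡ (trans (*-Σ C (- q) _) (Σ-cong C λ (l , s) → sym (strip-* v s (- q) _))) ⟩
    (Σ[ (l , s) ∈ C ] strip v s (λ r → behead b r (λ r′ → shuffles l r′ bs)))
      + (Σ[ (l , s) ∈ C ] strip v s (λ r → (- q) * behead b l (λ l′ → shuffles l′ r bs)))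
      ≈⟨ Σ-+ C _ _ ⟨
    _ ≈⟨ Σ-cong C (λ (l , s) → strip-+ v s _ _) ⟨
    (Σ[ (l , s) ∈ C ] strip v s (λ r → shuffles l r (b ∷ bs))) ∎
    where C = cuts [] z

  cuts-zippers : ∀ b l z (g : Biword → Biword → Carrier) →
    (Σ[ (l′ , s) ∈ cuts l z ] behead b s (g l′)) ≈ (Σ[ (l′ , x , r) ∈ zippers l z ] ⟦ x ≟ˡ b ⟧ * g l′ r)
  cuts-zippers b l []      g = +-identityʳ _
  cuts-zippers b l (x ∷ z) g = +-congˡ (cuts-zippers b (x ∷ l) z g)

  ⟦⟧-∷ : ∀ x y u v → ⟦ x ≟ˡ y ⟧ * ⟦ u ≟ᵇ v ⟧ ≈ ⟦ (x ∷ u) ≟ᵇ (y ∷ v) ⟧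
  ⟦⟧-∷ x y u v = trans (sym (⟦⟧-× (x ≟ˡ y) (u ≟ᵇ v)))
    (⟦⟧-⇔ ((x ≟ˡ y) ×-dec (u ≟ᵇ v)) ((x ∷ u) ≟ᵇ (y ∷ v))
      (λ { (≡.refl , ≡.refl) → ≡.refl }) (λ { ≡.refl → ≡.refl , ≡.refl }))

  -- As `bs` increases, the next biletter must be the smaller of the two heads. The interleaving is
  -- forced to be the merge, and each letter of `l` costs a factor `- q`.
  shuffles-merge : ∀ l r bs → Increasing bs → shuffles l r bs ≈ ⟦ merge≺ l r ≟ᵇ bs ⟧ * (- q) ^ length l
  shuffles-merge []      r []       _ = trans (*-identityˡ _) (sym (*-identityʳ _))
  shuffles-merge (y ∷ l) r []       _ = trans (zeroˡ _) (sym (⟦⟧*-no (merge≺ (y ∷ l) r ≟ᵇ []) λ eq →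
    ↭.¬x∷xs↭[] (≡.subst (y ∷ l ++ r ↭_) eq (↭-sym (merge≺-↭ (y ∷ l) r)))))
  shuffles-merge l r (b ∷ bs) inc = go l r
    where
    b≺ : All (b ≺_) bs
    b≺ = AllPairs.head (Linked.Linked⇒AllPairs <-trans inc)
    ih : ∀ l r → shuffles l r bs ≈ ⟦ merge≺ l r ≟ᵇ bs ⟧ * (- q) ^ length l
    ih l r = shuffles-merge l r bs (Linked.tail inc)

    fromʳ : ∀ z l r → ⟦ z ≟ˡ b ⟧ * shuffles l r bs ≈ ⟦ (z ∷ merge≺ l r) ≟ᵇ (b ∷ bs) ⟧ * (- q) ^ length l
    fromʳ z l r = trans (*-congˡ (ih l r))
        (trans (sym (*-assoc _ _ _)) (*-congʳ (⟦⟧-∷ z b (merge≺ l r) bs)))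

    fromˡ : ∀ y l r → (- q) * (⟦ y ≟ˡ b ⟧ * shuffles l r bs)
        ≈ ⟦ (y ∷ merge≺ l r) ≟ᵇ (b ∷ bs) ⟧ * ((- q) * (- q) ^ length l)
    fromˡ y l r = trans (*-congˡ (fromʳ y l r)) (x∙yz≈y∙xz _ _ _)

    -- The next biletter b precedes all of bs, so it cannot be taken after a letter still to come.
    late : ∀ x {y} l r → y ∈ merge≺ l r → ¬ x ≺ y → ⟦ x ≟ˡ b ⟧ * shuffles l r bs ≈ 0#
    late x l r y∈ x⊀y = trans (fromʳ x l r) (⟦⟧*-no ((x ∷ merge≺ l r) ≟ᵇ (b ∷ bs))
      λ { ≡.refl → x⊀y (All.lookup b≺ y∈) })

    go : ∀ l r → shuffles l r (b ∷ bs) ≈ ⟦ merge≺ l r ≟ᵇ (b ∷ bs) ⟧ * (- q) ^ length l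
    go []      []      = trans (+-identityˡ _) (trans (zeroʳ _) (sym (zeroˡ _)))
    go []      (z ∷ r) = trans (+-cong (fromʳ z [] r) (zeroʳ _)) (+-identityʳ _)
    go (y ∷ l) []      = trans (+-identityˡ _) (trans (fromˡ y l [])
      (reflexive (≡.cong (λ w → ⟦ (y ∷ w) ≟ᵇ (b ∷ bs) ⟧ * ((- q) * (- q) ^ length l)) (merge≺-[]ʳ l))))
    go (y ∷ l) (z ∷ r) with y ≺? z | fromʳ z (y ∷ l) r | fromˡ y l (z ∷ r)
    ... | yes y≺z | _ | eq = trans (+-cong
            (late z (y ∷ l) r (merge≺-∈ˡ (y ∷ l) r (here ≡.refl)) λ z≺y → n≮n _ (<-trans y≺z z≺y)) eq)
          (+-identityˡ _)
    ... | no y⊀z  | eq | _ = trans (+-cong eq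
            (trans (*-congˡ (late y l (z ∷ r) (merge≺-∈ʳ l (z ∷ r) (here ≡.refl)) y⊀z)) (zeroʳ _)))
          (+-identityʳ _)

  -- The initial biletter `(x , 1)` becomes the marked letter: `l` consists of what was adjoined on
  -- its left, `r` of what was adjoined on its right.
  coefficient-Ψ : ∀ f z → coefficient (Ψ f) z ≈
    (Σ[ b@(l , _) ∈ zippers [] z ] ⟦ toList (sorted b) ≟ᵇ biletters f ⟧ * (- q) ^ length l)
  coefficient-Ψ f@(x ∷ u) z = begin
    coefficient (Ψ f) z
      ≈⟨ coefficient-brackets ⟨ [ (x , 1) ] ⟩ bs z ⟩
    1# * grow [ (x , 1) ] bs z + 0#
      ≈⟨ trans (+-identityʳ _) (*-identityˡ _) ⟩
    grow [ (x , 1) ] bs z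
      ≈⟨ grow-cuts [ (x , 1) ] bs z ⟩
    (Σ[ (l , s) ∈ cuts [] z ] behead (x , 1) s (λ r → shuffles l r bs))
      ≈⟨ cuts-zippers (x , 1) [] z (λ l r → shuffles l r bs) ⟩
    (Σ[ (l , y , r) ∈ zippers [] z ] ⟦ y ≟ˡ (x , 1) ⟧ * shuffles l r bs)
      ≈⟨ Σ-cong (zippers [] z) (λ (l , y , r) → trans
           (*-congˡ (shuffles-merge l r bs (Linked.tail (increasing-biletters f))))
           (trans (sym (*-assoc _ _ _)) (*-congʳ (⟦⟧-∷ y (x , 1) (merge≺ l r) bs)))) ⟩
    (Σ[ b@(l , _) ∈ zippers [] z ] ⟦ toList (sorted b) ≟ᵇ biletters f ⟧ * (- q) ^ length l) ∎
    where bs = zip u (map (2 ℕ.+_) (upTo (length u)))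

  ψ-term : List⁺ ℕ → Block → Carrier
  ψ-term f b@(l , _) = ⟦ valley? b ×-dec (f ≟⁺ colorsᵇ b) ⟧ * (- q) ^ length l

  ψ : List⁺ ℕ → Biword → Carrier
  ψ f z = sumOver (zippers [] z) (ψ-term f)

  -- Ranks keep the shape and the colors of every marked block, so `ψ` can be read off `z` without
  -- standardizing.
  coefficient-Ψ-stdᵇ : ∀ f z → Unique (numbers z) → coefficient (Ψ f) (stdᵇ z) ≈ ψ f z
  coefficient-Ψ-stdᵇ f z z! = begin
    coefficient (Ψ f) (stdᵇ z)
      ≈⟨ coefficient-Ψ f (stdᵇ z) ⟩
    sumOver (zippers [] (stdᵇ z)) term
      ≈⟨ reflexive (≡.cong (λ bs → sumOver bs term) (zippers-relabel h [] z)) ⟩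
    sumOver (map (relabelᵇ h) (zippers [] z)) term
      ≈⟨ Σ-map (relabelᵇ h) (zippers [] z) term ⟩
    (Σ[ b ∈ zippers [] z ] term (relabelᵇ h b))
      ≈⟨ Σ-cong-∈ (zippers [] z) (λ {b@(l , x , r)} b∈ → *-cong
           (⟦⟧-⇔ (toList (sorted (relabelᵇ h b)) ≟ᵇ biletters f) (valley? b ×-dec (f ≟⁺ colorsᵇ b))
             (biletters⇒valley z z! b∈ f) (valley⇒biletters z z! b∈ f))
           (reflexive (≡.cong ((- q) ^_) (length-map (map₂ h) l)))) ⟩
    ψ f z ∎
    where
    h = rank (numbers z)
    term : Block → Carrier
    term b@(l , _) = ⟦ toList (sorted b) ≟ᵇ biletters f ⟧ * (- q) ^ length l

  -- Products of the elements `Ψ`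

  productΨ : List (List⁺ ℕ) → Formal
  productΨ fs = foldr _⋆_ ⟨ [] ⟩ (map Ψ fs)

  θ : List (List⁺ ℕ) → Biword → Carrier
  θ []       z = ⟦ [] ≟ᵇ z ⟧
  θ (f ∷ fs) z = Σ[ (u , v) ∈ splits z ] ψ f u * θ fs v

  splits-numbers-⊆ : ∀ {z u v} → (u , v) ∈ splits z → numbers u ++ numbers v ≡ numbers z
  splits-numbers-⊆ {z} {u} {v} uv∈ =
      ≡.trans (≡.sym (map-++ proj₂ u v)) (≡.cong numbers (++-splits z uv∈))

  mutual
    coefficient-productΨ-stdᵇ : ∀ fs z → Unique (numbers z) →
        coefficient (productΨ fs) (stdᵇ z) ≈ θ fs z
    coefficient-productΨ-stdᵇ []       []      _  = coefficient-⟨⟩ [] []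
    coefficient-productΨ-stdᵇ []       (x ∷ z) _  = coefficient-⟨⟩ [] (stdᵇ (x ∷ z))
    coefficient-productΨ-stdᵇ (f ∷ fs) z       z! = begin
      coefficient (Ψ f ⋆ productΨ fs) (stdᵇ z)
        ≈⟨ coefficient-⋆-∈ (Ψ f) (productΨ fs) (stdᵇ z)
            (≡.subst₂ (λ w n → w ∈ 𝔖 n) (≡.sym (numbers-stdᵇ z))
             (≡.trans (length-map proj₂ z) (≡.sym (stdᵇ-length z))) (std-∈-𝔖 z!)) ⟩
      (Σ[ uv ∈ splits (stdᵇ z) ] term uv)
        ≈⟨ reflexive (≡.cong (λ ps → sumOver ps term) (splits-relabel h z)) ⟩
      _ ≈⟨ Σ-map (λ (u , v) → relabel h u , relabel h v) (splits z) term ⟩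
      (Σ[ (u , v) ∈ splits z ] term (relabel h u , relabel h v))
        -- Standardizing a piece of a standardized word gives the same as standardizing the piece of
        -- the original word.
        ≈⟨ Σ-cong-∈ (splits z) (λ {(u , v)} uv∈ →
            reflexive (≡.cong₂ (λ u′ v′ → coefficient (Ψ f) u′ * coefficient (productΨ fs) v′)
             (stdᵇ-relabel u (λ x∈ y∈ → mono (⊆ˡ uv∈ x∈) (⊆ˡ uv∈ y∈)))
             (stdᵇ-relabel v (λ x∈ y∈ → mono (⊆ʳ uv∈ x∈) (⊆ʳ uv∈ y∈))))) ⟩
      (Σ[ uv ∈ splits z ] term uv)
        ≈⟨ Σ-θ f fs z z! ⟩
      θ (f ∷ fs) z ∎
      where
      h = rank (numbers z)
      mono : Monotone h (numbers z)
      mono = rank-monotone (numbers z)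
      term : Biword × Biword → Carrier
      term (u , v) = coefficient (Ψ f) (stdᵇ u) * coefficient (productΨ fs) (stdᵇ v)
      ⊆ˡ : ∀ {u v} → (u , v) ∈ splits z → numbers u ⊆ numbers z
      ⊆ˡ uv∈ x∈ = ≡.subst (_ ∈_) (splits-numbers-⊆ uv∈) (∈-++⁺ˡ x∈)
      ⊆ʳ : ∀ {u v} → (u , v) ∈ splits z → numbers v ⊆ numbers z
      ⊆ʳ {u} uv∈ x∈ = ≡.subst (_ ∈_) (splits-numbers-⊆ uv∈) (∈-++⁺ʳ (numbers u) x∈)

    Σ-θ : ∀ f fs z → Unique (numbers z) →
      (Σ[ (u , v) ∈ splits z ] coefficient (Ψ f) (stdᵇ u) * coefficient (productΨ fs) (stdᵇ v))
          ≈ θ (f ∷ fs) z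
    Σ-θ f fs z z! = Σ-cong-∈ (splits z) λ {(u , v)} uv∈ →
      let uv! = ≡.subst Unique (≡.sym (splits-numbers-⊆ uv∈)) z!
      in *-cong (coefficient-Ψ-stdᵇ f u (unique-++⁻ˡ (numbers u) uv!))
                (coefficient-productΨ-stdᵇ fs v (unique-++⁻ʳ (numbers u) uv!))

  coefficient-productΨ : ∀ fs w → numbers w ∈ 𝔖 (length w) → coefficient (productΨ fs) w ≈ θ fs w
  coefficient-productΨ []       w _  = coefficient-⟨⟩ [] w
  coefficient-productΨ (f ∷ fs) w w∈ = trans (coefficient-⋆-∈ (Ψ f) (productΨ fs) w w∈)
    (Σ-θ f fs w (IsPermutation.unique (∈-𝔖⁻ (length w) w∈)))

  -- Sums over blockings

  Σ-ascending : ∀ z (g : Biword → List Block → Carrier) →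
    (Σ[ (r , bs) ∈ ascending z ] g r bs) ≈ (Σ[ (r , v) ∈ splits z ] Σ[ bs ∈ blockings v ] g r bs)
  Σ-ascending []      g = sym (+-identityʳ _)
  Σ-ascending (y ∷ z) g = begin
    _ ≈⟨ Σ-++ (map ([] ,_) (descending [] (y ∷ z))) _ _ ⟩
    _ ≈⟨ +-cong (Σ-map ([] ,_) (descending [] (y ∷ z)) _) (begin
           _ ≈⟨ Σ-map (map₁ (y ∷_)) (ascending z) (λ (r , bs) → g r bs) ⟩
           _ ≈⟨ Σ-ascending z (g ∘ (y ∷_)) ⟩
           _ ≈⟨ Σ-map (map₁ (y ∷_)) (splits z) (λ (r , v) → Σ[ bs ∈ blockings v ] g r bs) ⟨
           (Σ[ (r , v) ∈ map (map₁ (y ∷_)) (splits z) ] Σ[ bs ∈ blockings v ] g r bs) ∎) ⟩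
    _ ∎

  Σ-descending : ∀ l z (g : List Block → Carrier) →
    sumOver (descending l z) g
    ≈ (Σ[ (l′ , x , y) ∈ zippers l z ] Σ[ (r , bs) ∈ ascending y ] g ((l′ , x , r) ∷ bs))
  Σ-descending l []      g = refl
  Σ-descending l (x ∷ z) g = trans (Σ-++ (map (λ (r , bs) → (l , x , r) ∷ bs) (ascending z)) _ g)
    (+-cong (Σ-map _ (ascending z) g) (Σ-descending (x ∷ l) z g))

  -- Cutting off a prefix and marking a letter in it amounts to marking a letter and then cutting
  -- the word behind it.
  Σ-splits-zippers : ∀ l z (g : Block → Biword → Carrier) →
    (Σ[ (u , v) ∈ splits z ] Σ[ b ∈ zippers l u ] g b v)
    ≈ (Σ[ (l′ , x , y) ∈ zippers l z ] Σ[ (r , v) ∈ splits y ] g (l′ , x , r) v)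
  Σ-splits-zippers l []      g = +-identityʳ _
  Σ-splits-zippers l (x ∷ z) g = begin
    _ ≈⟨ trans (+-identityˡ _) (Σ-map (map₁ (x ∷_)) (splits z)
        (λ (u , v) → Σ[ b ∈ zippers l u ] g b v)) ⟩
    _ ≈⟨ Σ-+ (splits z) (λ (u , v) → g (l , x , u) v) (λ (u , v) → Σ[ b ∈ zippers (x ∷ l) u ] g b v) ⟩
    _ ≈⟨ +-congˡ (Σ-splits-zippers (x ∷ l) z g) ⟩
    (Σ[ (l′ , y , v) ∈ zippers l (x ∷ z) ] Σ[ (r , v) ∈ splits v ] g (l′ , y , r) v) ∎

  φ-term : List (List⁺ ℕ) → List Block → Carrier
  φ-term fs bs = ⟦ All.all? valley? bs ×-dec (fs ≟ᶠ map colorsᵇ bs) ⟧ * (- q) ^ depth bs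

  φ-term-∷ : ∀ f fs b bs → φ-term (f ∷ fs) (b ∷ bs) ≈ ψ-term f b * φ-term fs bs
  φ-term-∷ f fs b@(l , _) bs = trans
    (*-cong (trans
      (⟦⟧-⇔ (All.all? valley? (b ∷ bs) ×-dec ((f ∷ fs) ≟ᶠ map colorsᵇ (b ∷ bs))) (V ×-dec W)
        (λ { (v ∷ vs , ≡.refl) → (v , ≡.refl) , (vs , ≡.refl) })
        (λ { ((v , ≡.refl) , (vs , ≡.refl)) → v ∷ vs , ≡.refl }))
      (⟦⟧-× V W)) (^-homo-* (- q) (length l) (depth bs)))
    (interchange _ _ _ _)
    where
    V = valley? b ×-dec (f ≟⁺ colorsᵇ b)
    W = All.all? valley? bs ×-dec (fs ≟ᶠ map colorsᵇ bs)

  θ-blockings : ∀ fs z → θ fs z ≈ sumOver (blockings z) (φ-term fs)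
  θ-blockings [] []      = sym (trans (+-identityʳ _) (*-identityˡ _))
  θ-blockings [] (x ∷ z) = sym (Σ-zero (blockings (x ∷ z)) λ {bs} bs∈ →
    ⟦⟧*-no (All.all? valley? bs ×-dec ([] ≟ᶠ map colorsᵇ bs)) λ (_ , eq) → nonempty bs bs∈ eq)
    where
    nonempty : ∀ bs → bs ∈ blockings (x ∷ z) → [] ≢ map colorsᵇ bs
    nonempty [] []∈ _ = ↭.¬x∷xs↭[] (↭-sym (blockings-↭ (x ∷ z) []∈))
  θ-blockings (f ∷ fs) [] = trans (+-identityʳ _)
      (trans (zeroˡ _) (sym (trans (+-identityʳ _) (zeroˡ _))))
  θ-blockings (f ∷ fs) z@(_ ∷ _) = begin
    (Σ[ (u , v) ∈ splits z ] ψ f u * θ fs v)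
      ≈⟨ Σ-cong (splits z) (λ (u , v) → Σ-* (zippers [] u) (θ fs v) (ψ-term f)) ⟩
    (Σ[ (u , v) ∈ splits z ] Σ[ b ∈ zippers [] u ] ψ-term f b * θ fs v)
      ≈⟨ Σ-splits-zippers [] z (λ b v → ψ-term f b * θ fs v) ⟩
    (Σ[ (l , x , y) ∈ zippers [] z ] Σ[ (r , v) ∈ splits y ] ψ-term f (l , x , r) * θ fs v)
      ≈⟨ Σ-cong (zippers [] z) (λ (l , x , y) → Σ-cong (splits y) λ (r , v) → begin
           ψ-term f (l , x , r) * θ fs v
             ≈⟨ *-congˡ (θ-blockings fs v) ⟩
           ψ-term f (l , x , r) * sumOver (blockings v) (φ-term fs)
             ≈⟨ *-Σ (blockings v) _ (φ-term fs) ⟩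
           (Σ[ bs ∈ blockings v ] ψ-term f (l , x , r) * φ-term fs bs)
             ≈⟨ Σ-cong (blockings v) (λ bs → φ-term-∷ f fs (l , x , r) bs) ⟨
           (Σ[ bs ∈ blockings v ] φ-term (f ∷ fs) ((l , x , r) ∷ bs)) ∎) ⟩
    (Σ[ (l , x , y) ∈ zippers [] z ] Σ[ (r , v) ∈ splits y ] Σ[ bs ∈ blockings v ]
      φ-term (f ∷ fs) ((l , x , r) ∷ bs))
      ≈⟨ Σ-cong (zippers [] z) (λ (l , x , y) →
          Σ-ascending y (λ r bs → φ-term (f ∷ fs) ((l , x , r) ∷ bs))) ⟨
    (Σ[ (l , x , y) ∈ zippers [] z ] Σ[ (r , bs) ∈ ascending y ] φ-term (f ∷ fs) ((l , x , r) ∷ bs))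
      ≈⟨ Σ-descending [] z (φ-term (f ∷ fs)) ⟨
    sumOver (blockings z) (φ-term (f ∷ fs)) ∎

  -- The automaton that weighs valid blockings

  value : ℕ → List Block → Carrier
  value m bs = ⟦ valid? m bs ⟧ * (- q) ^ depth bs

  φ-term-valid : ∀ σ bs → φ-term (dominatedFactorization σ) bs
      ≈ ⟦ σ ≟ʷ colors (letters bs) ⟧ * value 0 bs
  φ-term-valid σ bs = trans (*-congʳ (trans
    (⟦⟧-⇔ (All.all? valley? bs ×-dec (dominatedFactorization σ ≟ᶠ map colorsᵇ bs))
      ((σ ≟ʷ colors (letters bs)) ×-dec valid? 0 bs)
      (factorization⇒valid bs) (valid⇒factorization bs))
    (⟦⟧-× (σ ≟ʷ colors (letters bs)) (valid? 0 bs)))) (*-assoc _ _ _)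

  Σ-𝔖-blockings : ∀ n w → (Σ[ σ ∈ 𝔖 n ] θ (dominatedFactorization σ) w) ≈
    (Σ[ bs ∈ blockings w ] Σ[ σ ∈ 𝔖 n ] ⟦ σ ≟ʷ colors (letters bs) ⟧ * value 0 bs)
  Σ-𝔖-blockings n w = trans
    (Σ-cong (𝔖 n) λ σ → trans (θ-blockings (dominatedFactorization σ) w)
      (Σ-cong (blockings w) λ bs → φ-term-valid σ bs))
    (Σ-comm (𝔖 n) (blockings w) (λ σ bs → ⟦ σ ≟ʷ colors (letters bs) ⟧ * value 0 bs))

  -- Each blocking admits one `σ`. Since `letters bs` rearranges `w`, this `σ` lies in `𝔖 n` and
  -- every blocking is counted once.
  Σ-𝔖-θ-∈ : ∀ n w → colors w ∈ 𝔖 n →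
    (Σ[ σ ∈ 𝔖 n ] θ (dominatedFactorization σ) w) ≈ sumOver (blockings w) (value 0)
  Σ-𝔖-θ-∈ n w w∈ = trans (Σ-𝔖-blockings n w) (Σ-cong-∈ (blockings w) λ {bs} bs∈ →
    Σ-∈ _≟ʷ_ (λ _ → value 0 bs) (𝔖-unique n) (𝔖-resp-↭ n (↭.map⁺ proj₁ (↭-sym (blockings-↭ w bs∈))) w∈))

  Σ-𝔖-θ-∉ : ∀ n w → colors w ∉ 𝔖 n → (Σ[ σ ∈ 𝔖 n ] θ (dominatedFactorization σ) w) ≈ 0#
  Σ-𝔖-θ-∉ n w w∉ = trans (Σ-𝔖-blockings n w) (Σ-zero (blockings w) λ {bs} bs∈ →
    Σ-∉ _≟ʷ_ (𝔖 n) (λ _ → value 0 bs) λ c∈ → w∉ (𝔖-resp-↭ n (↭.map⁺ proj₁ (blockings-↭ w bs∈)) c∈))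

  -- Total weight of the ways to end a biword, when its current block is past its valley (up)
  -- and when it is not (down).
  mutual
    up : List (Bool × Bool) → Carrier
    up []            = 1#
    -- Staying in the block needs a rise and a color below that of the valley; the other choice is
    -- to begin a new block.
    up ((δ , ρ) ∷ s) = (if δ ∨ ρ then 0# else up s) + enter ρ s

    down : List (Bool × Bool) → Carrier
    -- A block without a valley cannot end the word.
    down []            = 0#
    -- The factor `- q` pays for the previous letter, now known to lie before the valley.
    down ((δ , ρ) ∷ s) = if δ then (- q) * enter ρ s else 0#

    enter : Bool → List (Bool × Bool) → Carrier
    -- Either the letter is a valley, hence a record, or it precedes the valley and its own color is
    -- free.
    enter ρ s = (if ρ then up s else 0#) + down s

  value-∷ : ∀ m l x r bs → value m ((l , x , r) ∷ bs) ≈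
    (⟦ validLeft? m l x ⟧ * (- q) ^ length l) * (⟦ validRight? x r ⟧ * value (proj₁ x) bs)
  value-∷ m l x r bs = begin
    ⟦ L ×-dec N ×-dec V ⟧ * (- q) ^ (length l ℕ.+ depth bs)
      ≈⟨ *-cong (trans (⟦⟧-× L (N ×-dec V)) (*-congˡ (⟦⟧-× N V)))
          (^-homo-* (- q) (length l) (depth bs)) ⟩
    (⟦ L ⟧ * (⟦ N ⟧ * ⟦ V ⟧)) * ((- q) ^ length l * (- q) ^ depth bs)
      ≈⟨ interchange _ _ _ _ ⟩
    (⟦ L ⟧ * (- q) ^ length l) * ((⟦ N ⟧ * ⟦ V ⟧) * (- q) ^ depth bs)
      ≈⟨ *-congˡ (*-assoc _ _ _) ⟩
    (⟦ L ⟧ * (- q) ^ length l) * (⟦ N ⟧ * (⟦ V ⟧ * (- q) ^ depth bs)) ∎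
    where
    L = validLeft? m l x
    N = validRight? x r
    V = valid? (proj₁ x) bs

  risingSum : ℕ × ℕ → Biword → Carrier
  risingSum x z = Σ[ (r , bs) ∈ ascending z ] ⟦ validRight? x r ⟧ * value (proj₁ x) bs

  Σ-descending-∷ : ∀ m l x z → sumOver (descending l (x ∷ z)) (value m) ≈
    (⟦ validLeft? m l x ⟧ * (- q) ^ length l) * risingSum x z + sumOver (descending (x ∷ l) z) (value m)
  Σ-descending-∷ m l x z = trans (Σ-++ (map (λ (r , bs) → (l , x , r) ∷ bs) (ascending z)) _ (value m))
    (+-congʳ (trans (Σ-map _ (ascending z) (value m)) (trans
      (Σ-cong (ascending z) λ (r , bs) → value-∷ m l x r bs)
      (sym (*-Σ (ascending z) _ (λ (r , bs) → ⟦ validRight? x r ⟧ * value (proj₁ x) bs))))))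

  -- Colors are compared with the valley, numbers with the last letter read; the mixed biletter
  -- `(proj₁ x , proj₂ y)` carries both.
  risingSum-∷ : ∀ x y z → risingSum x (y ∷ z) ≈
    ⟦ (x ≺? y) ×-dec (proj₁ y <? proj₁ x) ⟧ * risingSum (proj₁ x , proj₂ y) z
    + sumOver (descending [] (y ∷ z)) (value (proj₁ x))
  risingSum-∷ x y z = begin
    risingSum x (y ∷ z)
      ≈⟨ Σ-++ (map ([] ,_) (descending [] (y ∷ z))) _ _ ⟩
    _ ≈⟨ +-cong (trans (Σ-map ([] ,_) (descending [] (y ∷ z)) _)
           (Σ-cong (descending [] (y ∷ z)) λ bs → ⟦⟧*-yes (validRight? x []) ([-] , [])))
         (trans (Σ-map (map₁ (y ∷_)) (ascending z)
             (λ (r , bs) → ⟦ validRight? x r ⟧ * value (proj₁ x) bs))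
           (trans (Σ-cong (ascending z) λ (r , bs) → trans (*-congʳ (trans
             (⟦⟧-⇔ (validRight? x (y ∷ r)) (C ×-dec validRight? (proj₁ x , proj₂ y) r)
               (λ { (x≺y ∷ inc , y< ∷ r<) → (x≺y , y<) , (increasing-recolor inc , r<) })
               (λ { ((x≺y , y<) , (inc , r<)) → x≺y ∷ increasing-recolor inc , y< ∷ r< }))
             (⟦⟧-× C (validRight? (proj₁ x , proj₂ y) r)))) (*-assoc _ _ _))
           (sym (*-Σ (ascending z) ⟦ C ⟧ (λ (r , bs) →
               ⟦ validRight? (proj₁ x , proj₂ y) r ⟧ * value (proj₁ x) bs))))) ⟩
    sumOver (descending [] (y ∷ z)) (value (proj₁ x)) + ⟦ C ⟧ * risingSum (proj₁ x , proj₂ y) z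
      ≈⟨ +-comm _ _ ⟩
    ⟦ C ⟧ * risingSum (proj₁ x , proj₂ y) z + sumOver (descending [] (y ∷ z)) (value (proj₁ x)) ∎
    where C = (x ≺? y) ×-dec (proj₁ y <? proj₁ x)

  mutual
    -- Past a valley, its color is the running maximum, so a single `m` serves `risingSum` and
    -- `steps`.
    risingSum-up : ∀ m t z → Fresh m t z → risingSum (m , t) z ≈ up (steps m t z)
    risingSum-up m t []                _     = trans (+-identityʳ _)
      (trans (⟦⟧*-yes (validRight? (m , t) []) ([-] , [])) (*-identityˡ _))
    risingSum-up m t (y@(c , s) ∷ z) fresh = trans (risingSum-∷ (m , t) y z)
      (+-cong (continue (t <? s) (m ≤? c)) (descending-enter m t c s z fresh))
      where
      C = ((m , t) ≺? (c , s)) ×-dec (c <? m)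
      continue : Dec (t < s) → Dec (m ≤ c) → ⟦ C ⟧ * risingSum (m , s) z ≈
        (if not (does (t <? s)) ∨ does (m ≤? c) then 0# else up (steps (m ℕ.⊔ c) s z))
      continue (yes t<s) (no m≰c) rewrite dec-true (t <? s) t<s | dec-false (m ≤? c) m≰c
        | m≥n⇒m⊔n≡m (<⇒≤ (≰⇒> m≰c)) = trans (⟦⟧*-yes C (t<s , ≰⇒> m≰c))
          (risingSum-up m s z (≡.subst (λ k → Fresh k s z) (m≥n⇒m⊔n≡m (<⇒≤ (≰⇒> m≰c))) (fresh-⊔ fresh)))
      continue (no t≮s) _ rewrite dec-false (t <? s) t≮s = ⟦⟧*-no C (t≮s ∘ proj₁)
      continue (yes t<s) (yes m≤c) rewrite dec-true (t <? s) t<s | dec-true (m ≤? c) m≤c =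
        ⟦⟧*-no C (λ (_ , c<m) → <⇒≱ c<m m≤c)

    descending-enter : ∀ m t c s z → Fresh m t ((c , s) ∷ z) →
      sumOver (descending [] ((c , s) ∷ z)) (value m) ≈ enter (does (m ≤? c)) (steps (m ℕ.⊔ c) s z)
    descending-enter m t c s z fresh = trans (Σ-descending-∷ m [] (c , s) z)
      (+-cong (record? (m ≤? c)) (trans
        (descending-down m (m ℕ.⊔ c) (c , s) [] z
            (λ ≤ → ≤-trans (m≤m⊔n m c) ≤ , ≤-trans (m≤n⊔m m c) ≤ ∷ [])
          (λ { (m≤ , c≤ ∷ []) → ⊔-lub m≤ c≤ }) (fresh-⊔ fresh))
        (trans (⟦⟧*-yes (increasing? [ (c , s) ]) [-]) (*-identityˡ _))))
      where
      L = validLeft? m [] (c , s)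
      record? : Dec (m ≤ c) → (⟦ L ⟧ * 1#) * risingSum (c , s) z ≈
        (if does (m ≤? c) then up (steps (m ℕ.⊔ c) s z) else 0#)
      record? (yes m≤c) = trans (*-congʳ (*-identityʳ _)) (trans (⟦⟧*-yes L ([-] , [] , m≤c))
        (trans (risingSum-up c s z (fresh-tail fresh)) (reflexive (≡.trans
          (≡.cong (λ k → up (steps k s z)) (≡.sym (m≤n⇒m⊔n≡n m≤c)))
          (≡.cong (if_then up (steps (m ℕ.⊔ c) s z) else 0#) (≡.sym (dec-true (m ≤? c) m≤c)))))))
      record? (no m≰c) = trans (*-congʳ (*-identityʳ _)) (trans (⟦⟧*-no L λ (_ , _ , m≤c) → m≰c m≤c)
        (reflexive (≡.cong (if_then up (steps (m ℕ.⊔ c) s z) else 0#)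
            (≡.sym (dec-false (m ≤? c) m≰c)))))

    -- `M` is the maximum of `m` and the colors over `x ∷ l`, given by its universal property; a
    -- later valley has to exceed it. The letter `x` is paid for inside `down`, hence the exponent
    -- `length l`.
    descending-down : ∀ m M x l z →
      (∀ {c} → M ≤ c → m ≤ c × All (λ y → proj₁ y ≤ c) (x ∷ l)) →
      (∀ {c} → m ≤ c × All (λ y → proj₁ y ≤ c) (x ∷ l) → M ≤ c) →
      Fresh M (proj₂ x) z →
      sumOver (descending (x ∷ l) z) (value m) ≈
      ⟦ increasing? (x ∷ l) ⟧ * ((- q) ^ length l * down (steps M (proj₂ x) z))
    descending-down m M x l []              _  _  _ = sym (trans (*-congˡ (zeroʳ _)) (zeroʳ _))
    descending-down m M x l (y@(c , s) ∷ z) M⇒ ⇒M fresh@((M≢c ∷ _) ∷ _ , (t≢s ∷ _) ∷ _) =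
      trans (Σ-descending-∷ m (x ∷ l) y z) (trans (+-congˡ rest) (cases (t <? s) (M ≤? c)))
      where
      t = proj₂ x
      L = validLeft? m (x ∷ l) y
      I = increasing? (x ∷ l)
      I′ = increasing? (y ∷ x ∷ l)
      e = (- q) ^ length l
      D = down (steps (M ℕ.⊔ c) s z)

      rest : sumOver (descending (y ∷ x ∷ l) z) (value m) ≈ ⟦ I′ ⟧ * (((- q) * e) * D)
      rest = descending-down m (M ℕ.⊔ c) y (x ∷ l) z
        (λ ≤ → let m≤ , l≤ = M⇒ (≤-trans (m≤m⊔n M c) ≤) in m≤ , ≤-trans (m≤n⊔m M c) ≤ ∷ l≤)
        (λ { (m≤ , c≤ ∷ l≤) → ⊔-lub (⇒M (m≤ , l≤)) c≤ }) (fresh-⊔ fresh)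

      rising : M ≤ c → risingSum y z ≈ up (steps (M ℕ.⊔ c) s z)
      rising M≤c rewrite m≤n⇒m⊔n≡n M≤c = risingSum-up c s z (fresh-tail fresh)

      s<t : ¬ t < s → s < t
      s<t t≮s = ≤∧≢⇒< (≮⇒≥ t≮s) (t≢s ∘ ≡.sym)

      I′≈I : ¬ t < s → ⟦ I′ ⟧ ≈ ⟦ I ⟧
      I′≈I t≮s = ⟦⟧-⇔ I′ I Linked.tail (s<t t≮s ∷_)

      -- All pending colors are at most `M`, and `M ≢ c` makes the bound by the record `c` strict.
      L≈I : ¬ t < s → M ≤ c → ⟦ L ⟧ ≈ ⟦ I ⟧
      L≈I t≮s M≤c = ⟦⟧-⇔ L I (Linked.tail ∘ proj₁) λ inc → s<t t≮s ∷ inc ,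
        All.map (λ y≤M → ≤-<-trans y≤M (≤∧≢⇒< M≤c M≢c)) (proj₂ (M⇒ ≤-refl)) , proj₁ (M⇒ M≤c)

      regroup : ∀ i r → i * (((- q) * e) * r) ≈ i * (e * ((- q) * r))
      regroup i r = *-congˡ (trans (*-congʳ (*-comm (- q) e)) (*-assoc e (- q) r))

      cases : Dec (t < s) → Dec (M ≤ c) →
        (⟦ L ⟧ * ((- q) * e)) * risingSum y z + ⟦ I′ ⟧ * (((- q) * e) * D) ≈
        ⟦ I ⟧ * (e * down (steps M t (y ∷ z)))
      cases (yes t<s) _ rewrite dec-true (t <? s) t<s = begin
        (⟦ L ⟧ * ((- q) * e)) * risingSum y z + ⟦ I′ ⟧ * (((- q) * e) * D)
          ≈⟨ +-cong (trans (*-congʳ (⟦⟧*-no L (s≮t ∘ Linked.head ∘ proj₁))) (zeroˡ _))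
              (⟦⟧*-no I′ (s≮t ∘ Linked.head)) ⟩
        0# + 0#
          ≈⟨ +-identityˡ 0# ⟩
        0#
          ≈⟨ trans (*-congˡ (zeroʳ e)) (zeroʳ _) ⟨
        ⟦ I ⟧ * (e * 0#) ∎
        where
        s≮t : ¬ s < t
        s≮t s<t = n≮n _ (<-trans t<s s<t)
      cases (no t≮s) (yes M≤c) rewrite dec-false (t <? s) t≮s | dec-true (M ≤? c) M≤c = begin
        (⟦ L ⟧ * ((- q) * e)) * risingSum y z + ⟦ I′ ⟧ * (((- q) * e) * D)
          ≈⟨ +-cong (trans (*-cong (*-congʳ (L≈I t≮s M≤c)) (rising M≤c)) (*-assoc _ _ _))
              (*-congʳ (I′≈I t≮s)) ⟩
        ⟦ I ⟧ * (((- q) * e) * U) + ⟦ I ⟧ * (((- q) * e) * D)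
          ≈⟨ trans (*-congˡ (distribˡ _ U D)) (distribˡ _ _ _) ⟨
        ⟦ I ⟧ * (((- q) * e) * (U + D))
          ≈⟨ regroup ⟦ I ⟧ (U + D) ⟩
        ⟦ I ⟧ * (e * ((- q) * (U + D))) ∎
        where U = up (steps (M ℕ.⊔ c) s z)
      cases (no t≮s) (no M≰c) rewrite dec-false (t <? s) t≮s | dec-false (M ≤? c) M≰c = begin
        (⟦ L ⟧ * ((- q) * e)) * risingSum y z + ⟦ I′ ⟧ * (((- q) * e) * D)
          ≈⟨ +-cong (trans (*-congʳ (⟦⟧*-no L λ (_ , l< , m≤c) →
              M≰c (⇒M (m≤c , All.map <⇒≤ l<)))) (zeroˡ _))
               (trans (*-congʳ (I′≈I t≮s)) (regroup ⟦ I ⟧ D)) ⟩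
        0# + ⟦ I ⟧ * (e * ((- q) * D))
          ≈⟨ trans (+-identityˡ _) (*-congˡ (*-congˡ (*-congˡ (sym (+-identityˡ D))))) ⟩
        ⟦ I ⟧ * (e * ((- q) * (0# + D))) ∎

  -- The two terms correspond to the first letter being the valley of its block or lying before it.
  blockings-value : ∀ c s z → Fresh c s z →
    sumOver (blockings ((c , s) ∷ z)) (value 0) ≈ up (steps c s z) + down (steps c s z)
  blockings-value c s z fresh = trans (Σ-descending-∷ 0 [] (c , s) z) (+-cong
    (trans (*-congʳ (*-identityʳ _))
        (trans (⟦⟧*-yes (validLeft? 0 [] (c , s)) ([-] , [] , z≤n)) (risingSum-up c s z fresh)))
    (trans (descending-down 0 c (c , s) [] z (λ c≤ → z≤n , c≤ ∷ []) (λ { (_ , c≤ ∷ []) → c≤ }) fresh)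
      (trans (⟦⟧*-yes (increasing? [ (c , s) ]) [-]) (*-identityˡ _))))

  -- Recurrences for the product formula

  -- coeffIJ I J only depends on D = Des I and E = Des J.
  coefficientOf : List ℕ → List ℕ → Carrier
  coefficientOf D E =
    if does ((D ∖ map pred D) ⊆? E)
    then (- q) ^ length (D ∖ E) * (1# - q) ^ length (D ∩ E)
    else 0#

  weight : List Bool → List Bool → Carrier
  weight ds es = coefficientOf (positions ds) (positions es)

  if-⟦⟧ : ∀ {p} {P : Set p} (P? : Dec P) x → (if does P? then x else 0#) ≈ ⟦ P? ⟧ * x
  if-⟦⟧ (yes _) x = sym (*-identityˡ x)
  if-⟦⟧ (no _)  x = sym (zeroˡ x)

  -- The vanishing condition and the product of powers are compared separately, so each recurrence
  -- reduces to a statement on peaks and a count.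
  weight-≈ : ∀ ds es ds′ es′ k →
      (PeaksIn (positions ds) (positions es) → PeaksIn (positions ds′) (positions es′)) →
    (PeaksIn (positions ds′) (positions es′) → PeaksIn (positions ds) (positions es)) →
    (- q) ^ length (positions ds ∖ positions es) * (1# - q) ^ length (positions ds ∩ positions es) ≈
      k * ((- q) ^ length (positions ds′ ∖ positions es′)
          * (1# - q) ^ length (positions ds′ ∩ positions es′)) →
    weight ds es ≈ k * weight ds′ es′
  weight-≈ ds es ds′ es′ k ⇒ ⇐ eq = trans (if-⟦⟧ S _) (trans
    (*-cong (⟦⟧-⇔ S S′ (λ sub {x} → peaks⇒∖-pred (positions ds′) (⇒ (∖-pred⇒peaks ds sub)) {x})
                       (λ sub {x} → peaks⇒∖-pred (positions ds) (⇐ (∖-pred⇒peaks ds′ sub)) {x})) eq)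
    (trans (x∙yz≈y∙xz _ _ _) (*-congˡ (sym (if-⟦⟧ S′ _)))))
    where
    S  = (positions ds ∖ map pred (positions ds)) ⊆? positions es
    S′ = (positions ds′ ∖ map pred (positions ds′)) ⊆? positions es′

  weight-ascent : ∀ ρ ds es → weight (false ∷ ds) (ρ ∷ es) ≈ weight ds es
  weight-ascent ρ ds es = trans (weight-≈ (false ∷ ds) (ρ ∷ es) ds es 1#
      (peaks-tail false ρ ds es) (peaks-cons false ρ ds es (λ 1∈ _ → contradiction 1∈ (1∉positions ds)))
      (trans (reflexive (≡.cong₂ (λ i j → (- q) ^ i * (1# - q) ^ j) (length-∖ ρ ds es)
          (length-∩ ρ ds es)))
        (sym (*-identityˡ _))))
    (*-identityˡ _)

  weight-record : ∀ ds es → weight (true ∷ ds) (true ∷ es) ≈ (1# - q) * weight ds es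
  weight-record ds es = weight-≈ (true ∷ ds) (true ∷ es) ds es (1# - q)
    (peaks-tail true true ds es) (peaks-cons true true ds es (λ _ _ → here ≡.refl))
    (trans (reflexive (≡.cong₂ (λ i j → (- q) ^ i * (1# - q) ^ j)
        (≡.trans (length-∖-reject (map suc (positions ds)) (positions (true ∷ es)) (here ≡.refl))
            (length-∖ true ds es))
        (≡.trans (length-∩-accept (map suc (positions ds)) (positions (true ∷ es)) (here ≡.refl))
            (≡.cong suc (length-∩ true ds es)))))
      (x∙yz≈y∙xz _ _ _))

  -- The second descent keeps position 1 from ending its run, so a non-record is allowed there and
  -- counts as an element of `D ∖ E`.
  weight-descent : ∀ ds es → weight (true ∷ true ∷ ds) (false ∷ es) ≈ (- q) * weight (true ∷ ds) es
  weight-descent ds es = weight-≈ (true ∷ ds′) (false ∷ es) ds′ es (- q)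
    (peaks-tail true false ds′ es)
    (peaks-cons true false ds′ es (λ _ 1∉ → contradiction (here ≡.refl) 1∉))
    (trans (reflexive (≡.cong₂ (λ i j → (- q) ^ i * (1# - q) ^ j)
        (≡.trans (length-∖-accept (map suc (positions ds′)) (positions (false ∷ es)) (1∉positions es))
            (≡.cong suc (length-∖ false ds′ es)))
        (≡.trans (length-∩-reject (map suc (positions ds′)) (positions (false ∷ es)) (1∉positions es))
            (length-∩ false ds′ es))))
      (*-assoc _ _ _))
    where ds′ = true ∷ ds

  weight-peak : ∀ ds es → 1 ∉ positions ds → weight (true ∷ ds) (false ∷ es) ≈ 0#
  weight-peak ds es 1∉ = trans (if-⟦⟧ S _) (⟦⟧*-no S λ sub →
    1∉positions es (∖-pred⇒peaks (true ∷ ds) sub (here ≡.refl)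
        (1∉ ∘ suc-∈-positions⁻ true ds (s≤s z≤n))))
    where S = (positions (true ∷ ds) ∖ map pred (positions (true ∷ ds))) ⊆? positions (false ∷ es)

  weightᵇ : List (Bool × Bool) → Carrier
  weightᵇ s = weight (map proj₁ s) (map proj₂ s)

  split-1-q : ∀ x → x + (- q) * x ≈ (1# - q) * x
  split-1-q x = trans (+-congʳ (sym (*-identityˡ x))) (sym (distribʳ x 1# (- q)))

  -- Decides the case of a descent at a non-record, where up + down = (1 - q) down s.
  down-descent : ∀ ρ s → up ((true , ρ) ∷ s) + down ((true , ρ) ∷ s) ≈ weightᵇ ((true , ρ) ∷ s) →
    (1# - q) * down ((true , ρ) ∷ s) ≈ (- q) * weightᵇ ((true , ρ) ∷ s)
  down-descent ρ s eq = begin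
    (1# - q) * ((- q) * enter ρ s)
      ≈⟨ x∙yz≈y∙xz _ _ _ ⟩
    (- q) * ((1# - q) * enter ρ s)
      ≈⟨ *-congˡ (trans (sym (split-1-q _)) (trans (+-congʳ (sym (+-identityˡ _))) eq)) ⟩
    (- q) * weightᵇ ((true , ρ) ∷ s) ∎

  -- An ascent passes the total on unchanged, whether the block is continued or left. At a descent
  -- the two states differ by the factor `- q`, which is the origin of `1# - q`.
  up+down : ∀ s → up s + down s ≈ weightᵇ s
  up+down [] = trans (+-identityʳ _) (sym (*-identityˡ _))
  up+down ((false , false) ∷ s) = begin
    (up s + (0# + down s)) + 0#
      ≈⟨ trans (+-identityʳ _) (+-congˡ (+-identityˡ _)) ⟩
    up s + down s
      ≈⟨ up+down s ⟩
    weightᵇ s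
      ≈⟨ weight-ascent false (map proj₁ s) (map proj₂ s) ⟨
    weightᵇ ((false , false) ∷ s) ∎
  up+down ((false , true) ∷ s) = begin
    (0# + (up s + down s)) + 0#
      ≈⟨ trans (+-identityʳ _) (+-identityˡ _) ⟩
    up s + down s
      ≈⟨ up+down s ⟩
    weightᵇ s
      ≈⟨ weight-ascent true (map proj₁ s) (map proj₂ s) ⟨
    weightᵇ ((false , true) ∷ s) ∎
  up+down ((true , true) ∷ s) = begin
    (0# + (up s + down s)) + (- q) * (up s + down s)
      ≈⟨ trans (+-congʳ (+-identityˡ _)) (split-1-q _) ⟩
    (1# - q) * (up s + down s)
      ≈⟨ *-congˡ (up+down s) ⟩
    (1# - q) * weightᵇ s
      ≈⟨ weight-record (map proj₁ s) (map proj₂ s) ⟨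
    weightᵇ ((true , true) ∷ s) ∎
  up+down ((true , false) ∷ s) = begin
    (0# + (0# + down s)) + (- q) * (0# + down s)
      ≈⟨ +-cong (+-identityˡ _) refl ⟩
    (0# + down s) + (- q) * (0# + down s)
      ≈⟨ split-1-q _ ⟩
    (1# - q) * (0# + down s)
      ≈⟨ *-congˡ (+-identityˡ _) ⟩
    (1# - q) * down s
      ≈⟨ next s (up+down s) ⟩
    weightᵇ ((true , false) ∷ s) ∎
    where
    next : ∀ s → up s + down s ≈ weightᵇ s → (1# - q) * down s ≈ weightᵇ ((true , false) ∷ s)
    next []                _  = trans (zeroʳ _) (sym (weight-peak [] [] λ ()))
    -- Without a second descent no block can keep falling, and position 1 ends its run at a
    -- non-record: both sides vanish.
    next ((false , ρ) ∷ s) _  = trans (zeroʳ _)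
      (sym (weight-peak (false ∷ map proj₁ s) (ρ ∷ map proj₂ s) (1∉positions (map proj₁ s))))
    next ((true , ρ) ∷ s)  eq = trans (down-descent ρ s eq)
        (sym (weight-descent (map proj₁ s) (ρ ∷ map proj₂ s)))

  -- Coefficients of the expansion in the `R n I J`

  coefficient-R : ∀ n I J w → coefficient (R n I J) w ≈
    (Σ[ τ ∈ 𝔖 n ] ⟦ τ ≟ʷ numbers w ⟧ * (⟦ descentComposition τ ≟ʷ I ⟧ *
      (Σ[ σ ∈ 𝔖 n ] ⟦ σ ≟ʷ colors w ⟧ * ⟦ saillanceComposition σ ≟ʷ J ⟧)))
  coefficient-R n I J w = begin
    coefficient (R n I J) w
      ≈⟨ coefficient-∑ Ts _ w ⟩
    (Σ[ τ ∈ Ts ] coefficient (∑[ σ ∈ Ss ] ⟨ zip σ τ ⟩) w)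
      ≈⟨ Σ-filter (λ τ → descentComposition τ ≟ʷ I) (𝔖 n) _ ⟩
    (Σ[ τ ∈ 𝔖 n ] ⟦ descentComposition τ ≟ʷ I ⟧ * coefficient (∑[ σ ∈ Ss ] ⟨ zip σ τ ⟩) w)
      ≈⟨ Σ-cong-∈ (𝔖 n) (λ {τ} τ∈ → begin
           ⟦ descentComposition τ ≟ʷ I ⟧ * coefficient (∑[ σ ∈ Ss ] ⟨ zip σ τ ⟩) w
             ≈⟨ *-congˡ (inner τ τ∈) ⟩
           ⟦ descentComposition τ ≟ʷ I ⟧ * (⟦ τ ≟ʷ numbers w ⟧ * saillanceSum)
             ≈⟨ x∙yz≈y∙xz _ _ _ ⟩
           ⟦ τ ≟ʷ numbers w ⟧ * (⟦ descentComposition τ ≟ʷ I ⟧ * saillanceSum) ∎) ⟩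
    (Σ[ τ ∈ 𝔖 n ] ⟦ τ ≟ʷ numbers w ⟧ * (⟦ descentComposition τ ≟ʷ I ⟧ * saillanceSum)) ∎
    where
    Ts = filter (λ τ → descentComposition τ ≟ʷ I) (𝔖 n)
    Ss = filter (λ σ → saillanceComposition σ ≟ʷ J) (𝔖 n)
    saillanceSum = Σ[ σ ∈ 𝔖 n ] ⟦ σ ≟ʷ colors w ⟧ * ⟦ saillanceComposition σ ≟ʷ J ⟧

    zip-⟦⟧ : ∀ {σ τ} → σ ∈ 𝔖 n → τ ∈ 𝔖 n → ⟦ zip σ τ ≟ᵇ w ⟧ ≈ ⟦ τ ≟ʷ numbers w ⟧ * ⟦ σ ≟ʷ colors w ⟧
    zip-⟦⟧ {σ} {τ} σ∈ τ∈ = trans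
      (⟦⟧-⇔ (zip σ τ ≟ᵇ w) ((τ ≟ʷ numbers w) ×-dec (σ ≟ʷ colors w))
        (λ eq → ≡.trans (≡.sym (numbers-zip σ τ len)) (≡.cong numbers eq) ,
                ≡.trans (≡.sym (colors-zip σ τ len)) (≡.cong colors eq))
        (λ { (≡.refl , ≡.refl) → zip-colors-numbers w }))
      (⟦⟧-× (τ ≟ʷ numbers w) (σ ≟ʷ colors w))
      where len = ≡.trans (𝔖-length n σ∈) (≡.sym (𝔖-length n τ∈))

    inner : ∀ τ → τ ∈ 𝔖 n → coefficient (∑[ σ ∈ Ss ] ⟨ zip σ τ ⟩) w ≈ ⟦ τ ≟ʷ numbers w ⟧ * saillanceSum
    inner τ τ∈ = begin
      coefficient (∑[ σ ∈ Ss ] ⟨ zip σ τ ⟩) w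
        ≈⟨ trans (coefficient-∑ Ss _ w) (Σ-cong Ss λ σ → coefficient-⟨⟩ (zip σ τ) w) ⟩
      (Σ[ σ ∈ Ss ] ⟦ zip σ τ ≟ᵇ w ⟧)
        ≈⟨ Σ-filter (λ σ → saillanceComposition σ ≟ʷ J) (𝔖 n) _ ⟩
      (Σ[ σ ∈ 𝔖 n ] ⟦ saillanceComposition σ ≟ʷ J ⟧ * ⟦ zip σ τ ≟ᵇ w ⟧)
        ≈⟨ Σ-cong-∈ (𝔖 n) (λ σ∈ → trans (*-comm _ _) (trans (*-congʳ (zip-⟦⟧ σ∈ τ∈)) (*-assoc _ _ _))) ⟩
      (Σ[ σ ∈ 𝔖 n ] ⟦ τ ≟ʷ numbers w ⟧ * (⟦ σ ≟ʷ colors w ⟧ * ⟦ saillanceComposition σ ≟ʷ J ⟧))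
        ≈⟨ *-Σ (𝔖 n) ⟦ τ ≟ʷ numbers w ⟧ (λ σ → ⟦ σ ≟ʷ colors w ⟧ * ⟦ saillanceComposition σ ≟ʷ J ⟧) ⟨
      ⟦ τ ≟ʷ numbers w ⟧ * saillanceSum ∎

  compositionSum : ℕ → Formal
  compositionSum n = ∑[ I ∈ compositions n ] ∑[ J ∈ compositions n ] (coeffIJ I J • R n I J)

  coefficient-compositionSum : ∀ n w → coefficient (compositionSum n) w ≈
    (Σ[ I ∈ compositions n ] Σ[ J ∈ compositions n ] coeffIJ I J * coefficient (R n I J) w)
  coefficient-compositionSum n w =
    trans (coefficient-∑ (compositions n) _ w) (Σ-cong (compositions n) λ I →
      trans (coefficient-∑ (compositions n) _ w)
        (Σ-cong (compositions n) λ J → coefficient-• (coeffIJ I J) (R n I J) w))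

  coefficient-compositionSum-∉ : ∀ n w → ¬ (numbers w ∈ 𝔖 n × colors w ∈ 𝔖 n) →
    coefficient (compositionSum n) w ≈ 0#
  coefficient-compositionSum-∉ n w w∉ = trans (coefficient-compositionSum n w)
    (Σ-zero (compositions n) λ {I} _ → Σ-zero (compositions n) λ {J} _ →
      trans (*-congˡ (trans (coefficient-R n I J w) (vanishes I J (numbers w ∈ʷ? 𝔖 n)))) (zeroʳ _))
    where
    vanishes : ∀ I J → Dec (numbers w ∈ 𝔖 n) →
      (Σ[ τ ∈ 𝔖 n ] ⟦ τ ≟ʷ numbers w ⟧ * (⟦ descentComposition τ ≟ʷ I ⟧ *
        (Σ[ σ ∈ 𝔖 n ] ⟦ σ ≟ʷ colors w ⟧ * ⟦ saillanceComposition σ ≟ʷ J ⟧))) ≈ 0#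
    vanishes I J (no γ∉)  = Σ-∉ _≟ʷ_ (𝔖 n) _ γ∉
    vanishes I J (yes γ∈) = Σ-zero (𝔖 n) λ _ → trans (*-congˡ (trans (*-congˡ
      (Σ-∉ _≟ʷ_ (𝔖 n) (λ σ → ⟦ saillanceComposition σ ≟ʷ J ⟧) (λ v∈ → w∉ (γ∈ , v∈)))) (zeroʳ _)))
          (zeroʳ _)

  -- The rows of `w` determine `I` and `J`, and nothing is counted twice because `𝔖 n` and
  -- `compositions n` have no repetitions.
  coefficient-compositionSum-∈ : ∀ n w → numbers w ∈ 𝔖 n → colors w ∈ 𝔖 n →
    coefficient (compositionSum n) w
        ≈ coeffIJ (descentComposition (numbers w)) (saillanceComposition (colors w))
  coefficient-compositionSum-∈ n w γ∈ v∈ = begin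
    coefficient (compositionSum n) w
      ≈⟨ coefficient-compositionSum n w ⟩
    (Σ[ I ∈ compositions n ] Σ[ J ∈ compositions n ] coeffIJ I J * coefficient (R n I J) w)
      ≈⟨ Σ-cong (compositions n) (λ I → Σ-cong (compositions n) λ J → begin
           coeffIJ I J * coefficient (R n I J) w
             ≈⟨ *-congˡ (trans (coefficient-R n I J w) (trans (Σ-∈ _≟ʷ_ _ (𝔖-unique n) γ∈)
                  (*-congˡ (Σ-∈ _≟ʷ_ (λ σ → ⟦ saillanceComposition σ ≟ʷ J ⟧) (𝔖-unique n) v∈)))) ⟩
           coeffIJ I J * (⟦ I₀ ≟ʷ I ⟧ * ⟦ J₀ ≟ʷ J ⟧)
             ≈⟨ trans (x∙yz≈y∙xz _ _ _) (*-cong (⟦⟧-⇔ (I₀ ≟ʷ I) (I ≟ʷ I₀) ≡.sym ≡.sym)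
                  (trans (*-comm _ _) (*-congʳ (⟦⟧-⇔ (J₀ ≟ʷ J) (J ≟ʷ J₀) ≡.sym ≡.sym)))) ⟩
           ⟦ I ≟ʷ I₀ ⟧ * (⟦ J ≟ʷ J₀ ⟧ * coeffIJ I J) ∎) ⟩
    (Σ[ I ∈ compositions n ] Σ[ J ∈ compositions n ] ⟦ I ≟ʷ I₀ ⟧ * (⟦ J ≟ʷ J₀ ⟧ * coeffIJ I J))
      ≈⟨ Σ-cong (compositions n) (λ I → trans
           (sym (*-Σ (compositions n) ⟦ I ≟ʷ I₀ ⟧ (λ J → ⟦ J ≟ʷ J₀ ⟧ * coeffIJ I J)))
           (*-congˡ (Σ-∈ _≟ʷ_ (coeffIJ I) (compositions-unique n) J₀∈))) ⟩
    (Σ[ I ∈ compositions n ] ⟦ I ≟ʷ I₀ ⟧ * coeffIJ I J₀)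
      ≈⟨ Σ-∈ _≟ʷ_ (λ I → coeffIJ I J₀) (compositions-unique n) I₀∈ ⟩
    coeffIJ I₀ J₀ ∎
    where
    I₀ = descentComposition (numbers w)
    J₀ = saillanceComposition (colors w)
    I₀∈ : I₀ ∈ compositions n
    I₀∈ = lengths-∈-compositions (increasingFactors (numbers w))
      (≡.trans (≡.cong length (concat-increasingFactors (numbers w))) (𝔖-length n γ∈))
    J₀∈ : J₀ ∈ compositions n
    J₀∈ = lengths-∈-compositions (dominatedFactorization (colors w))
      (≡.trans (≡.cong length (IsDominatedFactorization.product (isDominatedFactorization (colors w))))
          (𝔖-length n v∈))

  -- Comparison of the two sides

  coefficient-productΨ-∉ : ∀ fs w → fs ≢ [] → numbers w ∉ 𝔖 (length w) →
      coefficient (productΨ fs) w ≈ 0#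
  coefficient-productΨ-∉ []       w ≢[] _  = contradiction ≡.refl ≢[]
  coefficient-productΨ-∉ (f ∷ fs) w _   w∉ = coefficient-⋆-∉ (Ψ f) (productΨ fs) w w∉

  coefficient-𝚿-∉ : ∀ n w σ → 1 ≤ n → σ ∈ 𝔖 n → numbers w ∉ 𝔖 (length w) → coefficient (𝚿 σ) w ≈ 0#
  coefficient-𝚿-∉ n w []      1≤n σ∈ _  = contradiction (𝔖-length n σ∈) (<⇒≢ 1≤n)
  coefficient-𝚿-∉ n w (x ∷ u) _   _  w∉ =
    coefficient-productΨ-∉ (dominatedFactorization (x ∷ u)) w (λ ()) w∉

  coefficient-Σ𝚿 : ∀ n w → numbers w ∈ 𝔖 (length w) →
    coefficient (∑[ σ ∈ 𝔖 n ] 𝚿 σ) w ≈ (Σ[ σ ∈ 𝔖 n ] θ (dominatedFactorization σ) w)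
  coefficient-Σ𝚿 n w w∈ = trans (coefficient-∑ (𝔖 n) 𝚿 w)
    (Σ-cong (𝔖 n) λ σ → coefficient-productΨ (dominatedFactorization σ) w w∈)

  up+down≈coeffIJ : ∀ c s z → up (steps c s z) + down (steps c s z) ≈
    coeffIJ (descentComposition (s ∷ numbers z)) (saillanceComposition (c ∷ colors z))
  up+down≈coeffIJ c s z = trans (up+down (steps c s z)) (reflexive (≡.cong₂ coefficientOf
    (≡.trans (≡.cong positions (steps-descents c s z)) (≡.sym (Des-descentComposition s (numbers z))))
    (≡.trans (≡.cong positions (steps-records c s z)) (≡.sym (Des-saillanceComposition c (colors z))))))

  -- Both sides are supported on biwords with both rows in `𝔖 n`. The bottom row is tested against
  -- `length w`, the form that the product requires; a top row in `𝔖 n` identifies this length with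
  -- `n`.
  Σ𝚿-expansion : ∀ n → 1 ≤ n → (∑[ σ ∈ 𝔖 n ] 𝚿 σ) ≋ compositionSum n
  Σ𝚿-expansion n 1≤n w with numbers w ∈ʷ? 𝔖 (length w) | colors w ∈ʷ? 𝔖 n
  ... | no γ∉ | _ = trans
    (trans (coefficient-∑ (𝔖 n) 𝚿 w) (Σ-zero (𝔖 n) λ {σ} σ∈ → coefficient-𝚿-∉ n w σ 1≤n σ∈ γ∉))
    (sym (coefficient-compositionSum-∉ n w λ (γ∈ , _) → γ∉
      (≡.subst (λ k → numbers w ∈ 𝔖 k) (≡.trans (≡.sym (𝔖-length n γ∈)) (length-map proj₂ w)) γ∈)))
  ... | yes γ∈ | no v∉ = trans (trans (coefficient-Σ𝚿 n w γ∈) (Σ-𝔖-θ-∉ n w v∉))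
    (sym (coefficient-compositionSum-∉ n w (v∉ ∘ proj₂)))
  Σ𝚿-expansion n 1≤n []            | yes _  | yes v∈ = contradiction (𝔖-length n v∈) (<⇒≢ 1≤n)
  Σ𝚿-expansion n 1≤n w@((c , s) ∷ z) | yes γ∈ | yes v∈ = begin
    coefficient (∑[ σ ∈ 𝔖 n ] 𝚿 σ) w
      ≈⟨ trans (coefficient-Σ𝚿 n w γ∈) (Σ-𝔖-θ-∈ n w v∈) ⟩
    sumOver (blockings w) (value 0)
      ≈⟨ blockings-value c s z (IsPermutation.unique (∈-𝔖⁻ n v∈) ,
          IsPermutation.unique (∈-𝔖⁻ (length w) γ∈)) ⟩
    up (steps c s z) + down (steps c s z)
      ≈⟨ up+down≈coeffIJ c s z ⟩
    coeffIJ (descentComposition (numbers w)) (saillanceComposition (colors w))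
      ≈⟨ coefficient-compositionSum-∈ n w (≡.subst (λ k → numbers w ∈ 𝔖 k)
           (≡.trans (≡.sym (length-map proj₁ w)) (𝔖-length n v∈)) γ∈) v∈ ⟨
    coefficient (compositionSum n) w ∎

corollary3p4 : ∀ {c ℓ} (K : CommutativeRing c ℓ) (q : CommutativeRing.Carrier K) →
    let open BiwordAlgebra K q in
    ∀ (n : ℕ) → 1 ≤ n →
    (∑[ σ ∈ 𝔖 n ] 𝚿 σ)
    ≋ (∑[ I ∈ compositions n ] ∑[ J ∈ compositions n ] (coeffIJ I J • R n I J))
corollary3p4 K q n 1≤n = Expansion.Σ𝚿-expansion K q n 1≤n
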